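{- Let $\mathbf{x}=(x_1,\ldots,x_{d+1})$, $\mathbf{n}=(n_1,\ldots,n_{d+1}) \in \mathbb{N}^{d+1}$ and denote by $\mathrm{FCP}(\mathbf{n})$ the set of fully complementary $d$-dimensional partitions inside a $(2n_1,\ldots,2n_{d+1})$-box. Then \begin{equation*} \sum_{\mathbf{n} \in \mathbb{N}^{d+1}} |\mathrm{FCP}(\mathbf{n})| \mathbf{x}^{\mathbf{n}} = \frac{\prod\limits_{i=1}^{d+1}x_i\left( \sum\limits_{i=1}^{d+1}\left(x_i^{ -1}+d x_i\right)-\sum\limits_{1 \leq i, j \leq d+1}x_ix_j^{ -1} \right) }{\left(1-\sum\limits_{i=1}^{d+1} x_i\right)\prod\limits_{i=1}^{d+1}(1-x_i)}. \end{equation*}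
   Context: A $d$-dimensional partition is an array $(\pi_{i_1,\ldots,i_d})$ of non-negative integers, all but finitely many zero, with $\pi_{\mathbf{i}}\ge \pi_{\mathbf{i}+e_k}$ for all $\mathbf{i}$ and $1\le k\le d$. It is identified with its Ferrers diagram $\lambda=\{(i_1,\ldots,i_d,k): 1\le k\le \pi_{i_1,\ldots,i_d}\}\subset \mathbb{N}_{>0}^{d+1}$; it is contained in an $(n_1,\ldots,n_{d+1})$-box if $\lambda\subseteq[n_1]\times\cdots\times[n_{d+1}]$. For $I\subseteq[d+1]$ let $\rho_I$ be the bijection of $[2n_1]\times\cdots\times[2n_{d+1}]$ sending $x_i\mapsto 2n_i+1-x_i$ for $i\in I$ and fixing the other coordinates. A partition is fully complementary inside a $(2n_1,\ldots,2n_{d+1})$-box if the sets $\rho_I(\lambda)$, $I\subseteq[d+1]$ of even size, are pairwise disjoint and their union is $[2n_1]\times\cdots\times[2n_{d+1}]$. Convention for the sum: if exactly one $n_{k}$ is $0$ and all others are positive, $\mathrm{FCP}(\mathbf{n})$ consists of a single "empty array" (count $1$); if two or more components of $\mathbf{n}$ are $0$, $\mathrm{FCP}(\mathbf{n})$ is empty (count $0$). -}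

module Defs where

open import Data.Bool using (Bool; true; false; _∧_; _∨_; not; if_then_else_)
open import Data.Nat as ℕ using (ℕ; zero; suc; _+_; _*_; _∸_)
open import Data.Integer as ℤ using (ℤ; +_; -_)
open import Data.Fin using (Fin; zero; suc)
open import Data.Bool.ListAction using (all; any)
open import Data.List using (List; []; _∷_; _++_; map; concatMap; length; filterᵇ; foldr; allFin; upTo)
open import Data.Vec using (Vec; []; _∷_; lookup; zipWith; replicate; updateAt)
open import Data.Vec.Properties using (≡-dec)
open import Data.Product using (_×_; _,_; proj₁; proj₂)
open import Data.Maybe using (Maybe; just; nothing)
open import Relation.Nullary.Decidable using (⌊_⌋)

initV : ∀ {A : Set} {n} → Vec A (suc n) → Vec A n
initV (x ∷ []) = []
initV (x ∷ y ∷ ys) = x ∷ initV (y ∷ ys)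

lastV : ∀ {A : Set} {n} → Vec A (suc n) → A
lastV (x ∷ []) = x
lastV (x ∷ y ∷ ys) = lastV (y ∷ ys)

range1 : ℕ → List ℕ
range1 m = map suc (upTo m)

box : ∀ {m} → Vec ℕ m → List (Vec ℕ m)
box [] = [] ∷ []
box (b ∷ bs) = concatMap (λ x → map (x ∷_) (box bs)) (range1 b)

_==ᵥ_ : ∀ {m} → Vec ℕ m → Vec ℕ m → Bool
u ==ᵥ v = ⌊ ≡-dec ℕ._≟_ u v ⌋

allFuns : ∀ {m} → List (Vec ℕ m) → List ℕ → List (Vec ℕ m → ℕ)
allFuns [] vs = (λ _ → 0) ∷ []
allFuns (p ∷ ps) vs =
  concatMap (λ v → map (λ f → λ q → if q ==ᵥ p then v else f q) (allFuns ps vs)) vs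

allSubsets : (m : ℕ) → List (Vec Bool m)
allSubsets zero = [] ∷ []
allSubsets (suc m) = concatMap (λ b → map (b ∷_) (allSubsets m)) (true ∷ false ∷ [])

evenSize : ∀ {m} → Vec Bool m → Bool
evenSize [] = true
evenSize (true ∷ bs) = not (evenSize bs)
evenSize (false ∷ bs) = evenSize bs

_==ᵦ_ : ∀ {m} → Vec Bool m → Vec Bool m → Bool
u ==ᵦ v = ⌊ ≡-dec Data.Bool._≟_ u v ⌋
  where import Data.Bool

unitV : ∀ {m} → Fin m → Vec ℕ m
unitV k = updateAt (replicate _ 0) k (λ _ → 1)

-- A d-dimensional partition π (array indexed by ℕ_{>0}^d) is
-- non-increasing in every direction: π(i + e_k) ≤ π(i).
-- For arrays vanishing outside the box [b_1]×…×[b_d] it suffices to check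
-- i inside the box (outside, both sides are 0).
isPartitionIn : ∀ {d} → Vec ℕ d → (Vec ℕ d → ℕ) → Bool
isPartitionIn {d} B π =
  all (λ i → all (λ k → π (zipWith _+_ i (unitV k)) ℕ.≤ᵇ π i) (allFin d)) (box B)

inDiagram : ∀ {d} → (Vec ℕ d → ℕ) → Vec ℕ (suc d) → Bool
inDiagram π p = (1 ℕ.≤ᵇ lastV p) ∧ (lastV p ℕ.≤ᵇ π (initV p))

ρ : ∀ {m} → Vec ℕ m → Vec Bool m → Vec ℕ m → Vec ℕ m
ρ [] [] [] = []
ρ (N ∷ Ns) (b ∷ bs) (x ∷ xs) = (if b then suc N ∸ x else x) ∷ ρ Ns bs xs

evenSubsets : (m : ℕ) → List (Vec Bool m)
evenSubsets m = filterᵇ evenSize (allSubsets m)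

-- λ is fully complementary in the box N (N = (2n_1,…,2n_{d+1})):
-- the sets ρ_I(λ), |I| even, are pairwise disjoint and cover the box.
-- Since ρ_I is an involution of the box, q ∈ ρ_I(λ) ⇔ ρ_I(q) ∈ λ.
isFullyComplementary : ∀ {d} → Vec ℕ (suc d) → (Vec ℕ d → ℕ) → Bool
isFullyComplementary {d} N π =
  all (λ q →
        all (λ I → all (λ J →
              (I ==ᵦ J) ∨ not (inDiagram π (ρ N I q) ∧ inDiagram π (ρ N J q)))
            (evenSubsets (suc d))) (evenSubsets (suc d))
      ∧ any (λ I → inDiagram π (ρ N I q)) (evenSubsets (suc d)))
    (box N)

zeros : ∀ {m} → Vec ℕ m → ℕ
zeros [] = 0
zeros (zero ∷ ns) = suc (zeros ns)
zeros (suc _ ∷ ns) = zeros ns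

-- |FCP(n)|: the number of fully complementary d-dimensional partitions inside
-- the (2n_1,…,2n_{d+1})-box (with the stated convention when some n_k = 0).
-- Partitions inside the box are arrays on [2n_1]×…×[2n_d] with values in
-- {0,…,2n_{d+1}} (zero elsewhere), enumerated by allFuns.
fcpCount : ∀ {d} → Vec ℕ (suc d) → ℕ
fcpCount {d} n with zeros n
... | zero = length (filterᵇ (λ π → isPartitionIn (initV N) π ∧ isFullyComplementary N π)
                              (allFuns (box (initV N)) (upTo (suc (lastV N)))))
  where N = Data.Vec.map (2 *_) n
... | suc zero = 1
... | suc (suc _) = 0

-- a Laurent polynomial: finite list of terms c · x^e, e ∈ ℤ^m
LPoly : ℕ → Set
LPoly m = List (ℤ × Vec ℤ m)

_+ₚ_ : ∀ {m} → LPoly m → LPoly m → LPoly m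
_+ₚ_ = _++_

-ₚ_ : ∀ {m} → LPoly m → LPoly m
-ₚ P = map (λ t → (- proj₁ t) , proj₂ t) P

_-ₚ_ : ∀ {m} → LPoly m → LPoly m → LPoly m
P -ₚ Q = P +ₚ (-ₚ Q)

_*ₚ_ : ∀ {m} → LPoly m → LPoly m → LPoly m
P *ₚ Q = concatMap (λ s → map (λ t → (proj₁ s ℤ.* proj₁ t) , zipWith ℤ._+_ (proj₂ s) (proj₂ t)) Q) P

constₚ : ∀ {m} → ℤ → LPoly m
constₚ c = (c , replicate _ (+ 0)) ∷ []

varPow : ∀ {m} → Fin m → ℤ → LPoly m
varPow i a = (+ 1 , updateAt (replicate _ (+ 0)) i (λ _ → a)) ∷ []

var : ∀ {m} → Fin m → LPoly m
var i = varPow i (+ 1)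

varInv : ∀ {m} → Fin m → LPoly m
varInv i = varPow i (- (+ 1))

sumₚ : ∀ {m} {A : Set} → List A → (A → LPoly m) → LPoly m
sumₚ xs f = foldr (λ a acc → f a +ₚ acc) [] xs

prodₚ : ∀ {m} {A : Set} → List A → (A → LPoly m) → LPoly m
prodₚ xs f = foldr (λ a acc → f a *ₚ acc) (constₚ (+ 1)) xs

sumℤ : List ℤ → ℤ
sumℤ = foldr ℤ._+_ (+ 0)

_==ℤᵥ_ : ∀ {m} → Vec ℤ m → Vec ℤ m → Bool
u ==ℤᵥ v = ⌊ ≡-dec ℤ._≟_ u v ⌋

coeffₚ : ∀ {m} → LPoly m → Vec ℤ m → ℤ
coeffₚ P e = sumℤ (map (λ t → if proj₂ t ==ℤᵥ e then proj₁ t else + 0) P)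

-- a formal (Laurent) series: coefficient function on exponents in ℤ^m
Series : ℕ → Set
Series m = Vec ℤ m → ℤ

_⊛_ : ∀ {m} → LPoly m → Series m → Series m
(P ⊛ F) e = sumℤ (map (λ t → proj₁ t ℤ.* F (zipWith ℤ._-_ e (proj₂ t))) P)

toℕVec : ∀ {m} → Vec ℤ m → Maybe (Vec ℕ m)
toℕVec [] = just []
toℕVec (+ a ∷ v) with toℕVec v
... | just w = just (a ∷ w)
... | nothing = nothing
toℕVec (ℤ.-[1+ _ ] ∷ v) = nothing

FCPSeries : (d : ℕ) → Series (suc d)
FCPSeries d e with toℕVec e
... | just n = + fcpCount {d} n
... | nothing = + 0

numerator : (d : ℕ) → LPoly (suc d)
numerator d =
  prodₚ (allFin (suc d)) var *ₚ
    ( sumₚ (allFin (suc d)) (λ i → varInv i +ₚ (constₚ (+ d) *ₚ var i))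
      -ₚ sumₚ (allFin (suc d)) (λ i → sumₚ (allFin (suc d)) (λ j → var i *ₚ varInv j)) )

denominator : (d : ℕ) → LPoly (suc d)
denominator d =
  (constₚ (+ 1) -ₚ sumₚ (allFin (suc d)) var) *ₚ
    prodₚ (allFin (suc d)) (λ i → constₚ (+ 1) -ₚ var i)

{-# OPTIONS --safe #-}
module Submission where

-- The map ρ_I x, for x in the lower orthant L = [n_1] × … × [n_{d+1}], identifies the box with pairs (I, x), and
-- a down-closed set is fully complementary iff it contains exactly one even and one odd I over each x.
-- Being down-closed forces the even I to be ∅ and the odd I to be a singleton {i}, so λ is a colouring
-- x ↦ i of L such that colour i persists when x_i increases and the other coordinates decrease. The corner
-- n has some colour i, hence so has its face x_i = n_i, and deleting that face leaves an arbitrary colouring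
-- for n − e_i: |FCP(n)| = Σ_i |FCP(n − e_i)| for positive n.
-- For the series, let p = Σ_{n ≥ 1} x^n, so that ∏ (1 − x_i) p = ∏ x_i. By the recurrence and the boundary
-- convention, (1 − Σ x_i) F = Q p, where Q is the second factor of the numerator.

open import Defs
open import Data.Bool using (Bool; true; false; T; not; _∧_; _∨_; _xor_; if_then_else_)
import Data.Bool.Properties as Bool
open import Data.Bool.ListAction using (all; any)
open import Data.Fin using (Fin; zero; suc)
import Data.Fin as Fin
import Data.Fin.Properties as Fin
open import Data.Fin.Subset using (⁅_⁆) renaming (⊥ to ∅)
open import Data.Integer using (ℤ; +_; -[1+_])
import Data.Integer as ℤ
import Data.Integer.Properties as ℤ
open import Data.Integer.Tactic.RingSolver using (solve-∀)
open import Data.List using (List; []; _∷_; _++_; map; concatMap; length; filterᵇ; allFin; upTo)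
import Data.List as List
import Data.List.Properties as List
open import Data.List.Membership.Propositional using (_∈_; _∉_; find; lose)
open import Data.List.Membership.Propositional.Properties
  using (∈-map⁺; ∈-map⁻; ∈-concatMap⁺; ∈-concatMap⁻; ∈-filter⁺; ∈-filter⁻; ∈-upTo⁺; ∈-upTo⁻; ∈-allFin; ∈-lookup)
import Data.List.Relation.Unary.All as All
import Data.List.Relation.Unary.All.Properties as All
open import Data.List.Relation.Unary.AllPairs using (AllPairs; []; _∷_)
import Data.List.Relation.Unary.AllPairs as AllPairs
import Data.List.Relation.Unary.AllPairs.Properties as AllPairs
open import Data.List.Relation.Unary.Any using (here; there; index)
import Data.List.Relation.Unary.Any.Properties as Any
open import Data.List.Relation.Unary.Unique.Propositional using (Unique)
import Data.List.Relation.Unary.Unique.Propositional.Properties as Unique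
open import Data.Maybe using (just; nothing)
open import Data.Nat using (ℕ; zero; suc; _+_; _*_; _∸_; _≤_; _<_; z≤n; s≤s; _≤′_; ≤′-refl; ≤′-step; _<ᵇ_)
import Data.Nat as ℕ
import Data.Nat.Properties as ℕ
open import Data.Product using (∃; _×_; _,_; proj₁; proj₂)
open import Data.Sum using (_⊎_; inj₁; inj₂)
open import Data.Unit using (⊤; tt)
open import Data.Vec using (Vec; []; _∷_; lookup; zipWith; replicate; updateAt; _∷ʳ_)
import Data.Vec as Vec
import Data.Vec.Properties as Vec
open import Data.Vec.Relation.Binary.Pointwise.Extensional using (Pointwise; ext; Pointwise-≡⇒≡) renaming (tail to tail⁺)
open Pointwise using (app)
open import Algebra.Properties.CommutativeSemigroup ℤ.*-commutativeSemigroup using () renaming (interchange to *-interchange)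
open import Function using (_∘_; Equivalence)
open import Relation.Binary using (tri<; tri≈; tri>)
open import Relation.Binary.PropositionalEquality
open import Relation.Nullary using (¬_; yes; no; Dec; contradiction; _×-dec_; _⊎-dec_; ¬?)
open import Relation.Nullary.Decidable using (map′; toWitness; fromWitness)

-- Counting lists

-- Shrinking I lowers ρ_I x. So if any even I puts ρ_I x into λ, then x itself lies in λ, and
-- disjointness leaves ∅ as the only even set over x. Arrays are functions, for which pointwise
-- agreement does not give equality. The lists of arrays are therefore counted through relations,
-- and two arrays are told apart by a point of the box where they differ. For the series, (x_i^-1 -
-- 1) p is the indicator of n_i = 0 with all other coordinates positive. Let G be the part of F on
-- positive exponents. Then F = G + Σ (x_i^-1 - 1) p, and the recurrence reads G = Σ (x_i G + (1 -
-- x_i) p), where (1 - x_i) p supplies the value 1 when n - e_i falls on the boundary. Eliminating G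
-- gives Q p; the coefficient d in Q is (d + 1) - 1, with d + 1 from the first sum and -1 from (1 -
-- x_i) p.

AllPairs-lookup : ∀ {A : Set} {R : A → A → Set} {xs : List A} → AllPairs R xs →
  ∀ {i j} → i Fin.< j → R (List.lookup xs i) (List.lookup xs j)
AllPairs-lookup (r ∷ _) {zero} {suc j} _ = All.lookup r (∈-lookup j)
AllPairs-lookup (_ ∷ rs) {suc i} {suc j} (s≤s i<j) = AllPairs-lookup rs i<j

-- The pigeonhole principle for a relation instead of a map. `D` stands in for inequality of
-- entries, because the entries will be functions and only a witnessed difference between them can
-- be refuted.
length-≤ : ∀ {A B : Set} {R : A → B → Set} {D : A → A → Set} {xs : List A} {ys : List B} →
  AllPairs D xs →
  (∀ {x} → x ∈ xs → ∃ λ y → y ∈ ys × R x y) →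
  (∀ {x x' y} → x ∈ xs → x' ∈ xs → y ∈ ys → R x y → R x' y → ¬ D x x') →
  length xs ≤ length ys
length-≤ {R = R} {xs = xs} {ys} pairs total inj = Fin.injective⇒≤ {f = f} f-inj
  where
  image : ∀ i → ∃ λ y → y ∈ ys × R (List.lookup xs i) y
  image i = total (∈-lookup i)

  f : Fin (length xs) → Fin (length ys)
  f i = index (proj₁ (proj₂ (image i)))

  related : ∀ i → R (List.lookup xs i) (List.lookup ys (f i))
  related i = subst (R _) (Any.lookup-index (proj₁ (proj₂ (image i)))) (proj₂ (proj₂ (image i)))

  ordered : ∀ {i j} → f i ≡ f j → ¬ i Fin.< j
  ordered {i} {j} eq i<j = inj (∈-lookup i) (∈-lookup j) (∈-lookup (f j))
    (subst (λ k → R _ (List.lookup ys k)) eq (related i)) (related j) (AllPairs-lookup pairs i<j)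

  f-inj : ∀ {i j} → f i ≡ f j → i ≡ j
  f-inj {i} {j} eq with Fin.<-cmp i j
  ... | tri< i<j _ _ = contradiction i<j (ordered eq)
  ... | tri≈ _ i≡j _ = i≡j
  ... | tri> _ _ j<i = contradiction j<i (ordered (sym eq))

module _ {A B : Set} {f : A → List B} where

  ∈-concatMap-intro : ∀ {x y xs} → x ∈ xs → y ∈ f x → y ∈ concatMap f xs
  ∈-concatMap-intro x∈ y∈ = ∈-concatMap⁺ f (lose x∈ y∈)

  ∈-concatMap-elim : ∀ {y} xs → y ∈ concatMap f xs → ∃ λ x → x ∈ xs × y ∈ f x
  ∈-concatMap-elim xs y∈ = find (∈-concatMap⁻ f {xs = xs} y∈)

  AllPairs-concatMap : ∀ {R : B → B → Set} {xs} → Unique xs →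
    (∀ {x} → x ∈ xs → AllPairs R (f x)) →
    (∀ {x x' y y'} → x ≢ x' → y ∈ f x → y' ∈ f x' → R y y') →
    AllPairs R (concatMap f xs)
  AllPairs-concatMap u within across = AllPairs.concat⁺
    (All.map⁺ (All.tabulate within))
    (AllPairs.map⁺ (AllPairs.map (λ x≢x' → All.tabulate λ y∈ → All.tabulate λ y'∈ → across x≢x' y∈ y'∈) u))

  length-concatMap : ∀ xs → length (concatMap f xs) ≡ List.foldr (λ x n → length (f x) + n) 0 xs
  length-concatMap [] = refl
  length-concatMap (x ∷ xs) = trans (List.length-++ (f x)) (cong (λ s → length (f x) + s) (length-concatMap xs))

-- Enumeration of functions on a finite list of points

==ᵥ-refl : ∀ {m} (u : Vec ℕ m) → (u ==ᵥ u) ≡ true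
==ᵥ-refl u with Vec.≡-dec ℕ._≟_ u u
... | yes _ = refl
... | no u≢u = contradiction refl u≢u

==ᵥ-≢ : ∀ {m} {u v : Vec ℕ m} → u ≢ v → (u ==ᵥ v) ≡ false
==ᵥ-≢ {u = u} {v} u≢v with Vec.≡-dec ℕ._≟_ u v
... | yes u≡v = contradiction u≡v u≢v
... | no _ = refl

override : ∀ {m} → Vec ℕ m → ℕ → (Vec ℕ m → ℕ) → Vec ℕ m → ℕ
override p v f q = if q ==ᵥ p then v else f q

override-same : ∀ {m} (p : Vec ℕ m) v f → override p v f p ≡ v
override-same p v f rewrite ==ᵥ-refl p = refl

override-≢ : ∀ {m} {p q : Vec ℕ m} v f → q ≢ p → override p v f q ≡ f q
override-≢ v f q≢p rewrite ==ᵥ-≢ q≢p = refl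

Unique-≢ : ∀ {A : Set} {x y : A} {xs} → Unique (x ∷ xs) → y ∈ xs → y ≢ x
Unique-≢ (x∉ ∷ _) y∈ refl = All.lookup x∉ y∈ refl

-- Inequality with a witness. It is refuted by agreement on `ps`, whereas refuting plain inequality
-- of functions would require extensionality.
DifferOn : ∀ {m} → List (Vec ℕ m) → (Vec ℕ m → ℕ) → (Vec ℕ m → ℕ) → Set
DifferOn ps f g = ∃ λ p → p ∈ ps × f p ≢ g p

module _ {m : ℕ} {vs : List ℕ} where

  allFuns-∷⁻ : ∀ {p : Vec ℕ m} {ps f} → f ∈ allFuns (p ∷ ps) vs →
    ∃ λ v → v ∈ vs × ∃ λ g → g ∈ allFuns ps vs × f ≡ override p v g
  allFuns-∷⁻ f∈ with ∈-concatMap-elim vs f∈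
  ... | v , v∈ , f∈′ with ∈-map⁻ _ f∈′
  ... | g , g∈ , f≡ = v , v∈ , g , g∈ , f≡

  allFuns-value : ∀ {ps : List (Vec ℕ m)} {f p} → f ∈ allFuns ps vs → p ∈ ps → f p ∈ vs
  allFuns-value {p₀ ∷ ps} {f} {p} f∈ p∈ with allFuns-∷⁻ {ps = ps} f∈
  ... | v , v∈ , g , g∈ , refl with Vec.≡-dec ℕ._≟_ p p₀
  ... | yes _ = v∈
  ... | no p≢ with p∈
  ...   | here p≡ = contradiction p≡ p≢
  ...   | there p∈ps = allFuns-value {ps} g∈ p∈ps

  allFuns-outside : ∀ {ps : List (Vec ℕ m)} {f p} → f ∈ allFuns ps vs → p ∉ ps → f p ≡ 0
  allFuns-outside {[]} (here refl) p∉ = refl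
  allFuns-outside {p₀ ∷ ps} f∈ p∉ with allFuns-∷⁻ {ps = ps} f∈
  ... | v , v∈ , g , g∈ , refl =
    trans (override-≢ v g (p∉ ∘ here)) (allFuns-outside {ps} g∈ (p∉ ∘ there))

  -- Agreement can hold only on `ps`, since the enumerated functions are 0 elsewhere while `g` is
  -- arbitrary there.
  allFuns-complete : ∀ {ps : List (Vec ℕ m)} → Unique ps → (g : Vec ℕ m → ℕ) → (∀ {p} → p ∈ ps → g p ∈ vs) →
    ∃ λ f → f ∈ allFuns ps vs × (∀ {p} → p ∈ ps → f p ≡ g p)
  allFuns-complete {[]} u g g∈ = _ , here refl , λ ()
  allFuns-complete {p₀ ∷ ps} u@(_ ∷ u′) g g∈ with allFuns-complete {ps} u′ g (g∈ ∘ there)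
  ... | f , f∈ , f≡ = override p₀ (g p₀) f
    , ∈-concatMap-intro (g∈ (here refl)) (∈-map⁺ (override p₀ (g p₀)) f∈)
    , λ { (here refl) → override-same p₀ (g p₀) f
        ; (there p∈) → trans (override-≢ (g p₀) f (Unique-≢ u p∈)) (f≡ p∈) }

  -- Either the values chosen at the head point differ, or a difference is inherited from the tail;
  -- updating the head point preserves it because that point does not recur in the tail.
  allFuns-distinct : ∀ {ps : List (Vec ℕ m)} → Unique ps → Unique vs → AllPairs (DifferOn ps) (allFuns ps vs)
  allFuns-distinct {[]} _ _ = All.[] ∷ []
  allFuns-distinct {p ∷ ps} u@(_ ∷ u′) v! = AllPairs-concatMap v!
    (λ {v} _ → AllPairs.map⁺ (AllPairs.map (λ {f} {g} → lift v {f} {g}) (allFuns-distinct u′ v!)))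
    (λ {v} {v'} v≢v' f∈ g∈ → p , here refl , differ v≢v' (∈-map⁻ _ f∈) (∈-map⁻ _ g∈))
    where
    lift : ∀ v {f g} → DifferOn ps f g → DifferOn (p ∷ ps) (override p v f) (override p v g)
    lift v {f} {g} (q , q∈ , f≢g) = q , there q∈ ,
      λ eq → f≢g (trans (sym (override-≢ v f (Unique-≢ u q∈))) (trans eq (override-≢ v g (Unique-≢ u q∈))))

    differ : ∀ {v v' f g fs} → v ≢ v' → (∃ λ f₀ → f₀ ∈ fs × f ≡ override p v f₀) →
      (∃ λ g₀ → g₀ ∈ fs × g ≡ override p v' g₀) → f p ≢ g p
    differ {v} {v'} v≢v' (f₀ , _ , refl) (g₀ , _ , refl) eq =
      v≢v' (trans (sym (override-same p v f₀)) (trans eq (override-same p v' g₀)))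

-- Boxes

lookup-ext : ∀ {A : Set} {m} {u v : Vec A m} → (∀ j → lookup u j ≡ lookup v j) → u ≡ v
lookup-ext h = Pointwise-≡⇒≡ (ext h)

module _ {R : ℕ → ℕ → Set} where

  cons⁺ : ∀ {m x a} {u v : Vec ℕ m} → R x a → Pointwise R u v → Pointwise R (x ∷ u) (a ∷ v)
  cons⁺ r h = ext λ { zero → r ; (suc j) → app h j }

  Pointwise-init : ∀ {m} {u v : Vec ℕ (suc m)} → Pointwise R u v → Pointwise R (initV u) (initV v)
  Pointwise-init {u = x ∷ []} {a ∷ []} h = ext λ ()
  Pointwise-init {u = x ∷ y ∷ xs} {a ∷ b ∷ as} h = cons⁺ (app h zero) (Pointwise-init (tail⁺ h))

  Pointwise-last : ∀ {m} {u v : Vec ℕ (suc m)} → Pointwise R u v → R (lastV u) (lastV v)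
  Pointwise-last {u = x ∷ []} {a ∷ []} h = app h zero
  Pointwise-last {u = x ∷ y ∷ xs} {a ∷ b ∷ as} h = Pointwise-last (tail⁺ h)

  Pointwise-∷ʳ : ∀ {m} {u v : Vec ℕ m} {k l} → Pointwise R u v → R k l → Pointwise R (u ∷ʳ k) (v ∷ʳ l)
  Pointwise-∷ʳ {u = []} {[]} h r = cons⁺ r h
  Pointwise-∷ʳ {u = x ∷ u} {a ∷ v} h r = cons⁺ (app h zero) (Pointwise-∷ʳ (tail⁺ h) r)

initV-∷ʳ : ∀ {m} (u : Vec ℕ m) k → initV (u ∷ʳ k) ≡ u
initV-∷ʳ [] k = refl
initV-∷ʳ (x ∷ []) k = refl
initV-∷ʳ (x ∷ y ∷ u) k = cong (x ∷_) (initV-∷ʳ (y ∷ u) k)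

lastV-∷ʳ : ∀ {m} (u : Vec ℕ m) k → lastV (u ∷ʳ k) ≡ k
lastV-∷ʳ [] k = refl
lastV-∷ʳ (x ∷ []) k = refl
lastV-∷ʳ (x ∷ y ∷ u) k = lastV-∷ʳ (y ∷ u) k

initV-∷ʳ-lastV : ∀ {m} (p : Vec ℕ (suc m)) → initV p ∷ʳ lastV p ≡ p
initV-∷ʳ-lastV (x ∷ []) = refl
initV-∷ʳ-lastV (x ∷ y ∷ p) = cong (x ∷_) (initV-∷ʳ-lastV (y ∷ p))

infix 4 _∈□_ _≤ᵥ_

InRange : ℕ → ℕ → Set
InRange x b = 1 ≤ x × x ≤ b

_∈□_ _≤ᵥ_ : ∀ {m} → Vec ℕ m → Vec ℕ m → Set
_∈□_ = Pointwise InRange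
_≤ᵥ_ = Pointwise _≤_

∈□-∷ʳ : ∀ {m} {u : Vec ℕ m} {k} {N : Vec ℕ (suc m)} → u ∈□ initV N → InRange k (lastV N) → u ∷ʳ k ∈□ N
∈□-∷ʳ {u = u} {k} {N} u∈ k∈ = subst (u ∷ʳ k ∈□_) (initV-∷ʳ-lastV N) (Pointwise-∷ʳ u∈ k∈)

∈-range1⁺ : ∀ {x b} → InRange x b → x ∈ range1 b
∈-range1⁺ {suc x} (_ , x<b) = ∈-map⁺ suc (∈-upTo⁺ x<b)

∈-range1⁻ : ∀ {x b} → x ∈ range1 b → InRange x b
∈-range1⁻ x∈ with ∈-map⁻ suc x∈
... | y , y∈ , refl = s≤s z≤n , ∈-upTo⁻ y∈

∈-box⁺ : ∀ {m} {p N : Vec ℕ m} → p ∈□ N → p ∈ box N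
∈-box⁺ {p = []} {[]} _ = here refl
∈-box⁺ {p = x ∷ p} {b ∷ N} p∈ = ∈-concatMap-intro (∈-range1⁺ (app p∈ zero)) (∈-map⁺ (x ∷_) (∈-box⁺ (tail⁺ p∈)))

∈-box⁻ : ∀ {m} {p N : Vec ℕ m} → p ∈ box N → p ∈□ N
∈-box⁻ {p = []} {[]} _ = ext λ ()
∈-box⁻ {p = x ∷ p} {b ∷ N} p∈ with ∈-concatMap-elim (range1 b) p∈
... | _ , x∈ , p∈′ with ∈-map⁻ _ p∈′
... | _ , q∈ , refl = cons⁺ (∈-range1⁻ x∈) (∈-box⁻ q∈)

box-unique : ∀ {m} (N : Vec ℕ m) → Unique (box N)
box-unique [] = All.[] ∷ []
box-unique (b ∷ N) = AllPairs-concatMap (Unique.map⁺ ℕ.suc-injective (Unique.upTo⁺ b))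
  (λ _ → Unique.map⁺ Vec.∷-injectiveʳ (box-unique N))
  (λ x≢y p∈ q∈ → differ x≢y (∈-map⁻ _ p∈) (∈-map⁻ _ q∈))
  where
  differ : ∀ {m x y} {p q : Vec ℕ (suc m)} {us vs} → x ≢ y → (∃ λ u → u ∈ us × p ≡ x ∷ u) →
    (∃ λ v → v ∈ vs × q ≡ y ∷ v) → p ≢ q
  differ x≢y (_ , _ , refl) (_ , _ , refl) refl = x≢y refl

-- The first coordinate is raised in unit steps above the tail `v`; the tail is then handled by
-- induction with the first coordinate fixed at `x`. Every step starts inside the box.
antitone : ∀ {m} {B : Vec ℕ m} (f : Vec ℕ m → ℕ) →
  (∀ {u} → u ∈□ B → ∀ k → f (zipWith _+_ u (unitV k)) ≤ f u) →
  ∀ {u v} → u ∈□ B → v ∈□ B → u ≤ᵥ v → f v ≤ f u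
antitone {B = []} f step {[]} {[]} _ _ _ = ℕ.≤-refl
antitone {B = b ∷ B} f step {x ∷ u} {y ∷ v} u∈ v∈ u≤v = ℕ.≤-trans
  (column (ℕ.≤⇒≤′ (app u≤v zero)) (proj₂ (app v∈ zero)))
  (antitone (f ∘ (x ∷_)) tail-step (tail⁺ u∈) (tail⁺ v∈) (tail⁺ u≤v))
  where
  tail-step : ∀ {w} → w ∈□ B → ∀ k → f (x ∷ zipWith _+_ w (unitV k)) ≤ f (x ∷ w)
  -- The unit vector in direction `suc k` has head 0, so `step` produces x + 0 in first place.
  tail-step {w} w∈ k = subst (λ z → f (z ∷ zipWith _+_ w (unitV k)) ≤ f (x ∷ w)) (ℕ.+-identityʳ x)
    (step (cons⁺ (app u∈ zero) w∈) (suc k))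

  column : ∀ {z} → x ≤′ z → z ≤ b → f (z ∷ v) ≤ f (x ∷ v)
  column ≤′-refl _ = ℕ.≤-refl
  column {suc z} (≤′-step x≤z) z<b = ℕ.≤-trans
    (subst (λ w → f w ≤ f (z ∷ v)) (cong₂ _∷_ (ℕ.+-comm z 1) (Vec.zipWith-identityʳ ℕ.+-identityʳ v))
      (step (cons⁺ (ℕ.≤-trans (proj₁ (app u∈ zero)) (ℕ.≤′⇒≤ x≤z) , ℕ.<⇒≤ z<b) (tail⁺ v∈)) zero))
    (column x≤z (ℕ.<⇒≤ z<b))

-- Subsets of coordinates and reflections

∈-allSubsets : ∀ {m} (I : Vec Bool m) → I ∈ allSubsets m
∈-allSubsets [] = here refl
∈-allSubsets (true ∷ I) = ∈-concatMap-intro {f = λ b → map (b ∷_) (allSubsets _)} {xs = true ∷ false ∷ []} (here refl) (∈-map⁺ (true ∷_) (∈-allSubsets I))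
∈-allSubsets (false ∷ I) = ∈-concatMap-intro {f = λ b → map (b ∷_) (allSubsets _)} {xs = true ∷ false ∷ []} (there (here refl)) (∈-map⁺ (false ∷_) (∈-allSubsets I))

∈-evenSubsets⁺ : ∀ {m} {I : Vec Bool m} → evenSize I ≡ true → I ∈ evenSubsets m
∈-evenSubsets⁺ {I = I} even = ∈-filter⁺ (Bool.T? ∘ evenSize) (∈-allSubsets I) (subst T (sym even) _)

∈-evenSubsets⁻ : ∀ {m} {I : Vec Bool m} → I ∈ evenSubsets m → evenSize I ≡ true
∈-evenSubsets⁻ {I = I} I∈ with evenSize I | proj₂ (∈-filter⁻ (Bool.T? ∘ evenSize) {xs = allSubsets _} I∈)
... | true | _ = refl

even-∅ : ∀ {m} → evenSize (∅ {m}) ≡ true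
even-∅ {zero} = refl
even-∅ {suc m} = even-∅ {m}

odd-⁅⁆ : ∀ {m} (i : Fin m) → evenSize ⁅ i ⁆ ≡ false
odd-⁅⁆ {suc m} zero = cong not (even-∅ {m})
odd-⁅⁆ (suc i) = odd-⁅⁆ i

infixl 6 _⊕_

_⊕_ : ∀ {m} → Vec Bool m → Vec Bool m → Vec Bool m
_⊕_ = zipWith _xor_

-- Parity is a homomorphism from symmetric difference to addition mod 2; the outer `not` appears
-- because `evenSize` encodes the neutral class by `true`.
even-⊕ : ∀ {m} (I J : Vec Bool m) → evenSize (I ⊕ J) ≡ not (evenSize I xor evenSize J)
even-⊕ [] [] = refl
even-⊕ (true ∷ I) (true ∷ J) =
  trans (even-⊕ I J) (cong not (sym (Bool.xor-annihilates-not (evenSize I) (evenSize J))))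
even-⊕ (true ∷ I) (false ∷ J) = cong not (trans (even-⊕ I J) (Bool.not-distribˡ-xor (evenSize I) (evenSize J)))
even-⊕ (false ∷ I) (true ∷ J) = cong not (trans (even-⊕ I J) (Bool.not-distribʳ-xor (evenSize I) (evenSize J)))
even-⊕ (false ∷ I) (false ∷ J) = even-⊕ I J

⊕-involutive : ∀ {m} (I K : Vec Bool m) → (I ⊕ K) ⊕ K ≡ I
⊕-involutive [] [] = refl
⊕-involutive (true ∷ I) (true ∷ K) = cong (true ∷_) (⊕-involutive I K)
⊕-involutive (true ∷ I) (false ∷ K) = cong (true ∷_) (⊕-involutive I K)
⊕-involutive (false ∷ I) (true ∷ K) = cong (false ∷_) (⊕-involutive I K)
⊕-involutive (false ∷ I) (false ∷ K) = cong (false ∷_) (⊕-involutive I K)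

⊕-self : ∀ {m} (I : Vec Bool m) → I ⊕ I ≡ ∅
⊕-self [] = refl
⊕-self (true ∷ I) = cong (false ∷_) (⊕-self I)
⊕-self (false ∷ I) = cong (false ∷_) (⊕-self I)

⊕-injectiveˡ : ∀ {m} {I J : Vec Bool m} K → I ⊕ K ≡ J ⊕ K → I ≡ J
⊕-injectiveˡ {I = I} {J} K eq = trans (sym (⊕-involutive I K)) (trans (cong (_⊕ K) eq) (⊕-involutive J K))

lookup-⁅⁆ : ∀ {m} (i : Fin m) → lookup ⁅ i ⁆ i ≡ true
lookup-⁅⁆ zero = refl
lookup-⁅⁆ (suc i) = lookup-⁅⁆ i

lookup-⁅⁆-≢ : ∀ {m} {i j : Fin m} → j ≢ i → lookup ⁅ i ⁆ j ≡ false
lookup-⁅⁆-≢ {i = zero} {zero} j≢i = contradiction refl j≢i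
lookup-⁅⁆-≢ {i = zero} {suc j} _ = Vec.lookup-replicate j false
lookup-⁅⁆-≢ {i = suc i} {zero} _ = refl
lookup-⁅⁆-≢ {i = suc i} {suc j} j≢i = lookup-⁅⁆-≢ (j≢i ∘ cong suc)

lookup-∅ : ∀ {m} (j : Fin m) → lookup ∅ j ≡ false
lookup-∅ j = Vec.lookup-replicate j false

lookup-⁅⁆⁻ : ∀ {m} {i : Fin m} j → lookup ⁅ i ⁆ j ≡ true → j ≡ i
lookup-⁅⁆⁻ {i = i} j h with j Fin.≟ i
... | yes j≡i = j≡i
... | no j≢i = contradiction (trans (sym h) (lookup-⁅⁆-≢ j≢i)) λ ()

⁅⁆-injective : ∀ {m} {i j : Fin m} → ⁅ i ⁆ ≡ ⁅ j ⁆ → i ≡ j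
⁅⁆-injective {i = i} eq = lookup-⁅⁆⁻ i (trans (cong (λ I → lookup I i) (sym eq)) (lookup-⁅⁆ i))

∅? : ∀ {m} (I : Vec Bool m) → I ≡ ∅ ⊎ ∃ λ i → lookup I i ≡ true
∅? [] = inj₁ refl
∅? (true ∷ I) = inj₂ (zero , refl)
∅? (false ∷ I) with ∅? I
... | inj₁ I≡∅ = inj₁ (cong (false ∷_) I≡∅)
... | inj₂ (i , h) = inj₂ (suc i , h)

lookup-ρ : ∀ {m} (N : Vec ℕ m) I x j →
  lookup (ρ N I x) j ≡ (if lookup I j then suc (lookup N j) ∸ lookup x j else lookup x j)
lookup-ρ (_ ∷ N) (_ ∷ I) (_ ∷ x) zero = refl
lookup-ρ (_ ∷ N) (_ ∷ I) (_ ∷ x) (suc j) = lookup-ρ N I x j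

ρ-∅ : ∀ {m} (N : Vec ℕ m) x → ρ N ∅ x ≡ x
ρ-∅ [] [] = refl
ρ-∅ (b ∷ N) (a ∷ x) = cong (a ∷_) (ρ-∅ N x)

reflect-involutive : ∀ {b x} → x ≤ b → suc b ∸ (suc b ∸ x) ≡ x
reflect-involutive x≤b = ℕ.m∸[m∸n]≡n (ℕ.m≤n⇒m≤1+n x≤b)

-- The reflections are an action of the subsets under symmetric difference. Membership in the box
-- enters because truncated subtraction is an involution only below its bound.
ρ-ρ : ∀ {m} {N : Vec ℕ m} {x} → x ∈□ N → ∀ I J → ρ N I (ρ N J x) ≡ ρ N (I ⊕ J) x
ρ-ρ {N = []} {[]} x∈ [] [] = refl
ρ-ρ {N = b ∷ N} {a ∷ x} x∈ (true ∷ I) (true ∷ J) = cong₂ _∷_ (reflect-involutive (proj₂ (app x∈ zero))) (ρ-ρ (tail⁺ x∈) I J)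
ρ-ρ {N = b ∷ N} {a ∷ x} x∈ (true ∷ I) (false ∷ J) = cong (_ ∷_) (ρ-ρ (tail⁺ x∈) I J)
ρ-ρ {N = b ∷ N} {a ∷ x} x∈ (false ∷ I) (true ∷ J) = cong (_ ∷_) (ρ-ρ (tail⁺ x∈) I J)
ρ-ρ {N = b ∷ N} {a ∷ x} x∈ (false ∷ I) (false ∷ J) = cong (_ ∷_) (ρ-ρ (tail⁺ x∈) I J)

ρ-∈□ : ∀ {m} {N : Vec ℕ m} {x} I → x ∈□ N → ρ N I x ∈□ N
ρ-∈□ {N = N} {x} I x∈ = ext bound
  where
  bound : ∀ j → InRange (lookup (ρ N I x) j) (lookup N j)
  bound j rewrite lookup-ρ N I x j with lookup I j
  ... | true = ℕ.m<n⇒0<n∸m (s≤s (proj₂ (app x∈ j))) , ℕ.∸-monoʳ-≤ (suc (lookup N j)) (proj₁ (app x∈ j))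
  ... | false = app x∈ j

-- Folding the doubled box onto its lower orthant

double : ∀ {m} → Vec ℕ m → Vec ℕ m
double = Vec.map (2 *_)

∈□-double : ∀ {m} {n x : Vec ℕ m} → x ∈□ n → x ∈□ double n
∈□-double {n = n} x∈ = ext λ j → proj₁ (app x∈ j) ,
  ℕ.≤-trans (proj₂ (app x∈ j)) (ℕ.≤-trans (ℕ.m≤m+n _ _) (ℕ.≤-reflexive (sym (Vec.lookup-map j (2 *_) n))))

-- `high` and `low` invert (I, x) ↦ ρ_I x: the first recovers I as the set of coordinates beyond the
-- centre, the second folds the point back to x.
high : ∀ {m} → Vec ℕ m → Vec ℕ m → Vec Bool m
high = zipWith _<ᵇ_

low : ∀ {m} → Vec ℕ m → Vec ℕ m → Vec ℕ m
low n p = ρ (double n) (high n p) p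

<ᵇ-true : ∀ {a x} → a < x → (a <ᵇ x) ≡ true
<ᵇ-true a<x = Equivalence.to Bool.T-≡ (ℕ.<⇒<ᵇ a<x)

<ᵇ-false : ∀ {a x} → x ≤ a → (a <ᵇ x) ≡ false
<ᵇ-false {a} {x} x≤a with a <ᵇ x in eq
... | false = refl
... | true = contradiction (ℕ.<ᵇ⇒< a x (subst T (sym eq) _)) (ℕ.≤⇒≯ x≤a)

above-centre : ∀ {a x} → x ≤ a → a < suc (2 * a) ∸ x
above-centre {a} {x} x≤a = ℕ.m+n≤o⇒m≤o∸n (suc a) (s≤s (ℕ.+-monoʳ-≤ a (ℕ.≤-trans x≤a (ℕ.≤-reflexive (sym (ℕ.+-identityʳ a))))))

below-centre : ∀ {a x} → a < x → suc (2 * a) ∸ x ≤ a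
below-centre {a} {x} a<x = ℕ.m≤n+o⇒m∸n≤o _ x (begin
  suc (a + (a + 0)) ≡⟨ cong (λ t → suc (a + t)) (ℕ.+-identityʳ a) ⟩
  suc a + a ≤⟨ ℕ.+-monoˡ-≤ a a<x ⟩
  x + a ∎)
  where open ℕ.≤-Reasoning

high-ρ : ∀ {m} {n x : Vec ℕ m} → x ∈□ n → ∀ I → high n (ρ (double n) I x) ≡ I
high-ρ {n = []} {[]} x∈ [] = refl
high-ρ {n = a ∷ n} {b ∷ x} x∈ (true ∷ I) = cong₂ _∷_ (<ᵇ-true (above-centre (proj₂ (app x∈ zero)))) (high-ρ (tail⁺ x∈) I)
high-ρ {n = a ∷ n} {b ∷ x} x∈ (false ∷ I) = cong₂ _∷_ (<ᵇ-false (proj₂ (app x∈ zero))) (high-ρ (tail⁺ x∈) I)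

low-ρ : ∀ {m} {n x : Vec ℕ m} → x ∈□ n → ∀ I → low n (ρ (double n) I x) ≡ x
low-ρ {n = n} {x} x∈ I = begin
  low n (ρ (double n) I x) ≡⟨ cong (λ J → ρ (double n) J (ρ (double n) I x)) (high-ρ x∈ I) ⟩
  ρ (double n) I (ρ (double n) I x) ≡⟨ ρ-ρ (∈□-double x∈) I I ⟩
  ρ (double n) (I ⊕ I) x ≡⟨ cong (λ J → ρ (double n) J x) (⊕-self I) ⟩
  ρ (double n) ∅ x ≡⟨ ρ-∅ (double n) x ⟩
  x ∎
  where open ≡-Reasoning

ρ-high-low : ∀ {m} {n p : Vec ℕ m} → p ∈□ double n → ρ (double n) (high n p) (low n p) ≡ p
ρ-high-low {n = n} {p} p∈ = trans (ρ-ρ p∈ (high n p) (high n p))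
  (trans (cong (λ J → ρ (double n) J p) (⊕-self (high n p))) (ρ-∅ (double n) p))

low-∈□ : ∀ {m} {n p : Vec ℕ m} → p ∈□ double n → low n p ∈□ n
low-∈□ {n = n} {p} p∈ = ext λ j → proj₁ (app (ρ-∈□ (high n p) p∈) j) , bound j
  where
  bound : ∀ j → lookup (low n p) j ≤ lookup n j
  bound j rewrite lookup-ρ (double n) (high n p) p j | Vec.lookup-zipWith _<ᵇ_ j n p | Vec.lookup-map j (2 *_) n
    with lookup n j <ᵇ lookup p j in eq
  ... | true = below-centre {x = lookup p j} (ℕ.<ᵇ⇒< _ _ (subst T (sym eq) _))
  ... | false = ℕ.≮⇒≥ λ lt → subst T eq (ℕ.<⇒<ᵇ lt)

-- Reflection reverses the order on coordinates in both sets, and coordinates in neither set keep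
-- it. A coordinate in `I` alone lies above the centre on the right and not above it on the left, so
-- it needs no comparison of `x` with `z`.
ρ-≤ᵥ : ∀ {m} {n x z : Vec ℕ m} {I J} → x ∈□ n → z ∈□ n →
  (∀ j → lookup J j ≡ true → lookup I j ≡ true) →
  (∀ j → lookup I j ≡ true → lookup J j ≡ true → lookup x j ≤ lookup z j) →
  (∀ j → lookup I j ≡ false → lookup z j ≤ lookup x j) →
  ρ (double n) J z ≤ᵥ ρ (double n) I x
ρ-≤ᵥ {n = n} {x} {z} {I} {J} x∈ z∈ J⊆I up down = ext bound
  where
  bound : ∀ j → lookup (ρ (double n) J z) j ≤ lookup (ρ (double n) I x) j
  bound j rewrite lookup-ρ (double n) I x j | lookup-ρ (double n) J z j | Vec.lookup-map j (2 *_) n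
    with lookup I j | lookup J j | J⊆I j | up j | down j
  ... | true | true | _ | u | _ = ℕ.∸-monoʳ-≤ (suc (2 * lookup n j)) (u refl refl)
  ... | true | false | _ | _ | _ = ℕ.≤-trans (proj₂ (app z∈ j)) (ℕ.<⇒≤ (above-centre (proj₂ (app x∈ j))))
  ... | false | true | s | _ | _ = contradiction (s refl) λ ()
  ... | false | false | _ | _ | d = d refl

-- Fully complementary sets and colourings

-- Formulated for arbitrary predicates on points, so that the set built from a colouring can be
-- treated before an array realises it.
record FullyComplementary {m : ℕ} (n : Vec ℕ m) (D : Vec ℕ m → Set) : Set where
  field
    down : ∀ {p q} → p ∈□ double n → q ∈□ double n → q ≤ᵥ p → D p → D q
    disjoint : ∀ {q I J} → q ∈□ double n → evenSize I ≡ true → evenSize J ≡ true →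
      D (ρ (double n) I q) → D (ρ (double n) J q) → I ≡ J
    cover : ∀ {q} → q ∈□ double n → ∃ λ I → evenSize I ≡ true × D (ρ (double n) I q)

-- `mono` is downward closure of the points ρ_{i} x written in terms of x: the reflection reverses
-- the order in coordinate i alone.
record Colouring {m : ℕ} (n : Vec ℕ m) (c : Fin m → Vec ℕ m → Set) : Set where
  field
    total : ∀ {x} → x ∈□ n → ∃ λ i → c i x
    unique : ∀ {x i j} → x ∈□ n → c i x → c j x → i ≡ j
    mono : ∀ {x z i} → x ∈□ n → z ∈□ n → lookup x i ≤ lookup z i →
      (∀ j → j ≢ i → lookup z j ≤ lookup x j) → c i x → c i z

colour : ∀ {m} → Vec ℕ m → (Vec ℕ m → Set) → Fin m → Vec ℕ m → Set
colour n D i x = D (ρ (double n) ⁅ i ⁆ x)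

lookup-⊕ : ∀ {m} (I J : Vec Bool m) j → lookup (I ⊕ J) j ≡ lookup I j xor lookup J j
lookup-⊕ I J j = Vec.lookup-zipWith _xor_ j I J

≢-true⇒false : ∀ {a b : Bool} → a ≡ true → b ≡ false → a ≢ b
≢-true⇒false refl refl ()

module FullyComplementaryProperties {m : ℕ} {n : Vec ℕ m} {D : Vec ℕ m → Set} (fc : FullyComplementary n D) where
  open FullyComplementary fc

  private
    R : Vec Bool m → Vec ℕ m → Vec ℕ m
    R = ρ (double n)

  ρ-∈ : ∀ {x} I → x ∈□ n → R I x ∈□ double n
  ρ-∈ I x∈ = ρ-∈□ I (∈□-double x∈)

  -- Disjointness concerns even sets only. Applied at the point ρ_I x to ∅ and J ⊕ I, which is even
  -- when I and J have equal parity, it covers odd pairs as well.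
  ρ-unique : ∀ {x I J} → x ∈□ n → evenSize I ≡ evenSize J → D (R I x) → D (R J x) → I ≡ J
  ρ-unique {x} {I} {J} x∈ eq DI DJ = sym (begin
    J ≡⟨ ⊕-involutive J I ⟨
    (J ⊕ I) ⊕ I ≡⟨ cong (_⊕ I) ∅≡J⊕I ⟨
    ∅ ⊕ I ≡⟨ Vec.zipWith-identityˡ (λ _ → refl) I ⟩
    I ∎)
    where
    open ≡-Reasoning
    even : evenSize (J ⊕ I) ≡ true
    even rewrite even-⊕ J I | eq with evenSize J
    ... | true = refl
    ... | false = refl
    ∅≡J⊕I : ∅ ≡ J ⊕ I
    ∅≡J⊕I = disjoint (ρ-∈ I x∈) (even-∅ {m}) even
      (subst D (sym (ρ-∅ (double n) (R I x))) DI)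
      (subst D (sym (trans (ρ-ρ (∈□-double x∈) (J ⊕ I) I) (cong (λ K → R K x) (⊕-involutive J I)))) DJ)

  ρ-below : ∀ {x I J} → x ∈□ n → (∀ j → lookup J j ≡ true → lookup I j ≡ true) → D (R I x) → D (R J x)
  ρ-below {x} {I} {J} x∈ J⊆I = down (ρ-∈ I x∈) (ρ-∈ J x∈)
    (ρ-≤ᵥ x∈ x∈ J⊆I (λ _ _ _ → ℕ.≤-refl) (λ _ _ → ℕ.≤-refl))

  ρ-∅-∈ : ∀ {x} → x ∈□ n → D (R ∅ x)
  ρ-∅-∈ x∈ with cover (∈□-double x∈)
  ... | I , _ , DI = ρ-below {I = I} x∈ (λ j h → contradiction (lookup-∅ j) (≢-true⇒false h refl)) DI

  -- Removing one element from an odd I leaves an even set, which lies in D only if it is empty.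
  classify : ∀ {x I} → x ∈□ n → D (R I x) → I ≡ ∅ ⊎ ∃ λ i → I ≡ ⁅ i ⁆
  classify {x} {I} x∈ DI with evenSize I in parity
  ... | true = inj₁ (ρ-unique x∈ (trans parity (sym (even-∅ {m}))) DI (ρ-∅-∈ x∈))
  ... | false with ∅? I
  ...   | inj₁ I≡∅ = inj₁ I≡∅
  ...   | inj₂ (i , Ii) = inj₂ (i , ⊕-injectiveˡ ⁅ i ⁆ (trans I⊕i≡∅ (sym (⊕-self ⁅ i ⁆))))
    where
    I⊕i⊆I : ∀ j → lookup (I ⊕ ⁅ i ⁆) j ≡ true → lookup I j ≡ true
    I⊕i⊆I j h with j Fin.≟ i
    ... | yes refl = Ii
    ... | no j≢i with lookup I j | lookup ⁅ i ⁆ j | lookup-⁅⁆-≢ j≢i | lookup-⊕ I ⁅ i ⁆ j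
    ...   | true | _ | _ | _ = refl
    ...   | false | false | refl | eq = trans (sym eq) h
    even : evenSize (I ⊕ ⁅ i ⁆) ≡ evenSize (∅ {m})
    even rewrite even-⊕ I ⁅ i ⁆ | parity | odd-⁅⁆ i = sym (even-∅ {m})
    I⊕i≡∅ : I ⊕ ⁅ i ⁆ ≡ ∅
    I⊕i≡∅ = ρ-unique x∈ even (ρ-below {I = I} x∈ I⊕i⊆I DI) (ρ-∅-∈ x∈)

  module _ (i₀ : Fin m) where

    -- An even set covering ρ_{i₀} x becomes, after adding {i₀} mod 2, an odd set over x, and
    -- `classify` makes it a singleton. The choice of i₀ is arbitrary; it provides an odd subset to
    -- start from.
    colour-total : ∀ {x} → x ∈□ n → ∃ λ i → colour n D i x
    colour-total {x} x∈ with cover (ρ-∈ ⁅ i₀ ⁆ x∈)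
    ... | K , even , DK = odd⇒singleton (classify x∈ DK⊕i)
      where
      DK⊕i : D (R (K ⊕ ⁅ i₀ ⁆) x)
      DK⊕i = subst D (ρ-ρ (∈□-double x∈) K ⁅ i₀ ⁆) DK
      odd : evenSize (K ⊕ ⁅ i₀ ⁆) ≡ false
      odd rewrite even-⊕ K ⁅ i₀ ⁆ | even | odd-⁅⁆ i₀ = refl
      odd⇒singleton : K ⊕ ⁅ i₀ ⁆ ≡ ∅ ⊎ (∃ λ i → K ⊕ ⁅ i₀ ⁆ ≡ ⁅ i ⁆) → ∃ λ i → colour n D i x
      odd⇒singleton (inj₁ eq) = contradiction (trans (sym (cong evenSize eq)) odd) (≢-true⇒false (even-∅ {m}) refl)
      odd⇒singleton (inj₂ (i , eq)) = i , subst (λ I → D (R I x)) eq DK⊕i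

    colouring : Colouring n (colour n D)
    colouring = record
      { total = colour-total
      ; unique = λ {_} {i} {j} x∈ ci cj → ⁅⁆-injective (ρ-unique x∈ (trans (odd-⁅⁆ i) (sym (odd-⁅⁆ j))) ci cj)
      ; mono = λ {x} {z} {i} x∈ z∈ x≤z z≤x → down (ρ-∈ ⁅ i ⁆ x∈) (ρ-∈ ⁅ i ⁆ z∈)
          (ρ-≤ᵥ x∈ z∈ (λ _ h → h)
            (λ j h _ → subst (λ k → lookup x k ≤ lookup z k) (sym (lookup-⁅⁆⁻ j h)) x≤z)
            (λ j h → z≤x j λ { refl → ≢-true⇒false (lookup-⁅⁆ j) refl h }))
      }

-- Two fully complementary sets with the same colours agree, because classify leaves no other points.
colour-determines : ∀ {m} {n : Vec ℕ m} {D E} → FullyComplementary n D → FullyComplementary n E →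
  (∀ {x} i → x ∈□ n → colour n D i x → colour n E i x) → ∀ {p} → p ∈□ double n → D p → E p
colour-determines {n = n} {D} {E} fcD fcE D⇒E {p} p∈ Dp = subst E (ρ-high-low p∈) (transfer (classify x∈ DI))
  where
  open FullyComplementaryProperties fcD
  x∈ : low n p ∈□ n
  x∈ = low-∈□ p∈
  DI : D (ρ (double n) (high n p) (low n p))
  DI = subst D (sym (ρ-high-low p∈)) Dp
  transfer : high n p ≡ ∅ ⊎ (∃ λ i → high n p ≡ ⁅ i ⁆) → E (ρ (double n) (high n p) (low n p))
  transfer (inj₁ eq) = subst (λ I → E (ρ (double n) I (low n p))) (sym eq)
    (FullyComplementaryProperties.ρ-∅-∈ fcE x∈)
  transfer (inj₂ (i , eq)) = subst (λ I → E (ρ (double n) I (low n p))) (sym eq)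
    (D⇒E i x∈ (subst (λ I → D (ρ (double n) I (low n p))) eq DI))

high-mono : ∀ {m} {n p q : Vec ℕ m} → q ≤ᵥ p → ∀ j → lookup (high n q) j ≡ true → lookup (high n p) j ≡ true
high-mono {n = n} {p} {q} q≤p j h rewrite Vec.lookup-zipWith _<ᵇ_ j n q | Vec.lookup-zipWith _<ᵇ_ j n p =
  <ᵇ-true (ℕ.<-≤-trans (ℕ.<ᵇ⇒< _ _ (subst T (sym h) _)) (app q≤p j))

⊆∅ : ∀ {m} {I : Vec Bool m} → (∀ j → lookup I j ≡ true → lookup (∅ {m}) j ≡ true) → I ≡ ∅
⊆∅ {I = I} h with ∅? I
... | inj₁ eq = eq
... | inj₂ (i , Ii) = contradiction (lookup-∅ i) (≢-true⇒false (h i Ii) refl)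

⊆⁅⁆ : ∀ {m} {I : Vec Bool m} {i} → (∀ j → lookup I j ≡ true → lookup ⁅ i ⁆ j ≡ true) → I ≡ ∅ ⊎ I ≡ ⁅ i ⁆
⊆⁅⁆ {I = I} {i} h with ∅? I
... | inj₁ eq = inj₁ eq
... | inj₂ (k , Ik) with lookup-⁅⁆⁻ {i = i} k (h k Ik)
...   | refl = inj₂ (lookup-ext same)
  where
  same : ∀ j → lookup I j ≡ lookup ⁅ k ⁆ j
  same j with j Fin.≟ k | lookup I j in eq
  ... | yes refl | _ = trans (sym eq) (trans Ik (sym (lookup-⁅⁆ k)))
  ... | no j≢k | true = sym (h j eq)
  ... | no j≢k | false = sym (lookup-⁅⁆-≢ j≢k)

low-up : ∀ {m} {n p q : Vec ℕ m} j → q ≤ᵥ p → lookup (high n p) j ≡ true → lookup (high n q) j ≡ true →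
  lookup (low n p) j ≤ lookup (low n q) j
low-up {n = n} {p} {q} j q≤p hp hq rewrite lookup-ρ (double n) (high n p) p j | lookup-ρ (double n) (high n q) q j | hp | hq =
  ℕ.∸-monoʳ-≤ (suc (lookup (double n) j)) (app q≤p j)

low-down : ∀ {m} {n p q : Vec ℕ m} j → q ≤ᵥ p → lookup (high n p) j ≡ false → lookup (high n q) j ≡ false →
  lookup (low n q) j ≤ lookup (low n p) j
low-down {n = n} {p} {q} j q≤p hp hq rewrite lookup-ρ (double n) (high n p) p j | lookup-ρ (double n) (high n q) q j | hp | hq =
  app q≤p j

-- The inverse construction to `colour`: the whole lower orthant, together with one reflected point
-- ρ_{i} x for each x of colour i.
Coloured : ∀ {m} → Vec ℕ m → (Fin m → Vec ℕ m → Set) → Vec ℕ m → Set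
Coloured n c p = high n p ≡ ∅ ⊎ ∃ λ i → high n p ≡ ⁅ i ⁆ × c i (low n p)

Coloured? : ∀ {m} (n : Vec ℕ m) {c} → (∀ i x → Dec (c i x)) → ∀ p → Dec (Coloured n c p)
Coloured? n c? p = Vec.≡-dec Bool._≟_ (high n p) ∅ ⊎-dec
  Fin.any? λ i → Vec.≡-dec Bool._≟_ (high n p) ⁅ i ⁆ ×-dec c? i (low n p)

module ColouringProperties {m : ℕ} {n : Vec ℕ m} {c : Fin m → Vec ℕ m → Set} (col : Colouring n c) where
  open Colouring col

  private
    R : Vec Bool m → Vec ℕ m → Vec ℕ m
    R = ρ (double n)

  Hue : Vec Bool m → Vec ℕ m → Set
  Hue I x = I ≡ ∅ ⊎ ∃ λ i → I ≡ ⁅ i ⁆ × c i x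

  Coloured⇒Hue : ∀ {x I} → x ∈□ n → Coloured n c (R I x) → Hue I x
  Coloured⇒Hue {x} {I} x∈ = subst₂ Hue (high-ρ x∈ I) (low-ρ x∈ I)

  Hue⇒Coloured : ∀ {x I} → x ∈□ n → Hue I x → Coloured n c (R I x)
  Hue⇒Coloured {x} {I} x∈ = subst₂ Hue (sym (high-ρ x∈ I)) (sym (low-ρ x∈ I))

  colour-Coloured⁻ : ∀ {x i} → x ∈□ n → colour n (Coloured n c) i x → c i x
  colour-Coloured⁻ {x} {i} x∈ h with Coloured⇒Hue {I = ⁅ i ⁆} x∈ h
  ... | inj₁ eq = contradiction (lookup-∅ i) (≢-true⇒false (trans (cong (λ I → lookup I i) (sym eq)) (lookup-⁅⁆ i)) refl)
  ... | inj₂ (j , eq , cj) = subst (λ k → c k x) (sym (⁅⁆-injective eq)) cj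

  colour-Coloured⁺ : ∀ {x i} → x ∈□ n → c i x → colour n (Coloured n c) i x
  colour-Coloured⁺ {i = i} x∈ ci = Hue⇒Coloured {I = ⁅ i ⁆} x∈ (inj₂ (i , refl , ci))

  Hue-unique : ∀ {x I J} → x ∈□ n → evenSize I ≡ evenSize J → Hue I x → Hue J x → I ≡ J
  Hue-unique x∈ _ (inj₁ refl) (inj₁ refl) = refl
  Hue-unique x∈ e (inj₁ refl) (inj₂ (j , refl , _)) = contradiction e (≢-true⇒false (even-∅ {m}) (odd-⁅⁆ j))
  Hue-unique x∈ e (inj₂ (i , refl , _)) (inj₁ refl) = contradiction (sym e) (≢-true⇒false (even-∅ {m}) (odd-⁅⁆ i))
  Hue-unique x∈ _ (inj₂ (i , refl , ci)) (inj₂ (j , refl , cj)) = cong ⁅_⁆ (unique x∈ ci cj)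

  Hue-exists : ∀ {x} → x ∈□ n → ∀ b → ∃ λ I → evenSize I ≡ b × Hue I x
  Hue-exists x∈ true = ∅ , even-∅ {m} , inj₁ refl
  Hue-exists x∈ false with total x∈
  ... | i , ci = ⁅ i ⁆ , odd-⁅⁆ i , inj₂ (i , refl , ci)

  -- Going down shrinks the set of high coordinates, so {i} becomes ∅ or stays {i}. In the second
  -- case the folded point grows in coordinate i and shrinks in the others, which is the situation
  -- of `mono`.
  Coloured-down : ∀ {p q} → p ∈□ double n → q ∈□ double n → q ≤ᵥ p → Coloured n c p → Coloured n c q
  Coloured-down {p} {q} p∈ q∈ q≤p (inj₁ eq) =
    inj₁ (⊆∅ λ j h → subst (λ I → lookup I j ≡ true) eq (high-mono {n = n} q≤p j h))
  Coloured-down {p} {q} p∈ q∈ q≤p (inj₂ (i , eq , ci))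
    with ⊆⁅⁆ {I = high n q} {i} (λ j h → subst (λ I → lookup I j ≡ true) eq (high-mono {n = n} q≤p j h))
  ... | inj₁ eq′ = inj₁ eq′
  ... | inj₂ eq′ = inj₂ (i , eq′ , mono (low-∈□ p∈) (low-∈□ q∈)
    (low-up {n = n} i q≤p (at eq (lookup-⁅⁆ i)) (at eq′ (lookup-⁅⁆ i)))
    (λ j j≢i → low-down {n = n} j q≤p (at eq (lookup-⁅⁆-≢ j≢i)) (at eq′ (lookup-⁅⁆-≢ j≢i))) ci)
    where
    at : ∀ {I J : Vec Bool m} {j b} → I ≡ J → lookup J j ≡ b → lookup I j ≡ b
    at refl h = h

  -- The point ρ_I q folds to `low n q` with set I ⊕ `high n q`. As I runs over the even sets, these
  -- are all sets of the parity of `high n q`, and exactly one of them is a `Hue`: ∅, or the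
  -- singleton of the colour.
  Coloured-fullyComplementary : FullyComplementary n (Coloured n c)
  Coloured-fullyComplementary = record { down = Coloured-down ; disjoint = disjoint ; cover = cover }
    where
    unfold : ∀ {q} I → q ∈□ double n → R I q ≡ R (I ⊕ high n q) (low n q)
    unfold {q} I q∈ = trans (cong (R I) (sym (ρ-high-low q∈))) (ρ-ρ (∈□-double (low-∈□ q∈)) I (high n q))

    disjoint : ∀ {q I J} → q ∈□ double n → evenSize I ≡ true → evenSize J ≡ true →
      Coloured n c (R I q) → Coloured n c (R J q) → I ≡ J
    disjoint {q} {I} {J} q∈ evenI evenJ hI hJ = ⊕-injectiveˡ (high n q)
      (Hue-unique x∈ parity (Coloured⇒Hue x∈ (subst (Coloured n c) (unfold I q∈) hI))
                            (Coloured⇒Hue x∈ (subst (Coloured n c) (unfold J q∈) hJ)))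
      where
      x∈ : low n q ∈□ n
      x∈ = low-∈□ q∈
      parity : evenSize (I ⊕ high n q) ≡ evenSize (J ⊕ high n q)
      parity rewrite even-⊕ I (high n q) | even-⊕ J (high n q) | evenI | evenJ = refl

    cover : ∀ {q} → q ∈□ double n → ∃ λ I → evenSize I ≡ true × Coloured n c (R I q)
    cover {q} q∈ with Hue-exists (low-∈□ q∈) (evenSize (high n q))
    ... | I , parity , hue = I ⊕ high n q , even ,
      subst (Coloured n c) (sym (trans (unfold (I ⊕ high n q) q∈)
          (cong (λ K → R K (low n q)) (⊕-involutive I (high n q)))))
        (Hue⇒Coloured {I = I} (low-∈□ q∈) hue)
      where
      even : evenSize (I ⊕ high n q) ≡ true
      even rewrite even-⊕ I (high n q) | parity with evenSize (high n q)
      ... | true = refl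
      ... | false = refl

-- Enumerating the partitions

T-all⁻ : ∀ {A : Set} {p : A → Bool} {xs x} → T (all p xs) → x ∈ xs → T (p x)
T-all⁻ {p = p} {xs} h x∈ = All.lookup (All.all⁺ p xs h) x∈

T-all⁺ : ∀ {A : Set} {p : A → Bool} {xs} → (∀ {x} → x ∈ xs → T (p x)) → T (all p xs)
T-all⁺ {p = p} h = All.all⁻ p (All.tabulate h)

Λ : ∀ {d} → (Vec ℕ d → ℕ) → Vec ℕ (suc d) → Set
Λ π p = T (inDiagram π p)

Λ⁻ : ∀ {d} (π : Vec ℕ d → ℕ) p → Λ π p → lastV p ≤ π (initV p)
Λ⁻ π p h = ℕ.≤ᵇ⇒≤ _ _ (proj₂ (Equivalence.to Bool.T-∧ h))

Λ⁺ : ∀ {d} (π : Vec ℕ d → ℕ) p → 1 ≤ lastV p → lastV p ≤ π (initV p) → Λ π p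
Λ⁺ π p 1≤ ≤π = Equivalence.from Bool.T-∧ (ℕ.≤⇒≤ᵇ 1≤ , ℕ.≤⇒≤ᵇ ≤π)

T-==ᵦ : ∀ {m} {I J : Vec Bool m} → T (I ==ᵦ J) → I ≡ J
T-==ᵦ = toWitness

exclusive⁻ : ∀ {m} {I J : Vec Bool m} {a b} → T ((I ==ᵦ J) ∨ not (a ∧ b)) → T a → T b → I ≡ J
exclusive⁻ {a = true} {true} h _ _ with Equivalence.to Bool.T-∨ h
... | inj₁ eq = T-==ᵦ eq

exclusive⁺ : ∀ {m} {I J : Vec Bool m} {a b} → (T a → T b → I ≡ J) → T ((I ==ᵦ J) ∨ not (a ∧ b))
exclusive⁺ {I = I} {J} {a} {b} h = Equivalence.from (Bool.T-∨ {I ==ᵦ J}) (cases a b h)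
  where
  cases : ∀ a b → (T a → T b → I ≡ J) → T (I ==ᵦ J) ⊎ T (not (a ∧ b))
  cases true true h = inj₁ (fromWitness (h _ _))
  cases true false h = inj₂ _
  cases false _ h = inj₂ _

partitions : ∀ {d} → Vec ℕ (suc d) → List (Vec ℕ d → ℕ)
partitions n = filterᵇ (λ π → isPartitionIn (initV (double n)) π ∧ isFullyComplementary (double n) π)
  (allFuns (box (initV (double n))) (upTo (suc (lastV (double n)))))

∈□? : ∀ {m} (u B : Vec ℕ m) → Dec (u ∈□ B)
∈□? u B = map′ ext app (Fin.all? λ j → (1 ℕ.≤? lookup u j) ×-dec (lookup u j ℕ.≤? lookup B j))

module _ {P : ℕ → Set} (P? : ∀ k → Dec (P k)) where

  -- The default 0 is the array entry of a column that misses the set.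
  height : ℕ → ℕ
  height zero = 0
  height (suc M) with P? (suc M)
  ... | yes _ = suc M
  ... | no _ = height M

  height-≤ : ∀ M → height M ≤ M
  height-≤ zero = z≤n
  height-≤ (suc M) with P? (suc M)
  ... | yes _ = ℕ.≤-refl
  ... | no _ = ℕ.m≤n⇒m≤1+n (height-≤ M)

  height-attained : ∀ M → 1 ≤ height M → P (height M)
  height-attained (suc M) 1≤ with P? (suc M)
  ... | yes p = p
  ... | no _ = height-attained M 1≤

  height-maximal : ∀ {k} M → P k → k ≤ M → k ≤ height M
  height-maximal zero _ k≤ = k≤
  height-maximal {k} (suc M) Pk k≤ with P? (suc M)
  ... | yes _ = k≤
  ... | no ¬P = height-maximal M Pk (ℕ.≤-pred (ℕ.≤∧≢⇒< k≤ λ { refl → ¬P Pk }))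

module _ {d : ℕ} {n : Vec ℕ (suc d)} where

  private
    N : Vec ℕ (suc d)
    N = double n
    B : Vec ℕ d
    B = initV N
    E : List (Vec Bool (suc d))
    E = evenSubsets (suc d)

  ∈-partitions⁻ : ∀ {π} → π ∈ partitions n →
    π ∈ allFuns (box B) (upTo (suc (lastV N))) × T (isPartitionIn B π) × T (isFullyComplementary N π)
  ∈-partitions⁻ π∈ with ∈-filter⁻ (Bool.T? ∘ λ π → isPartitionIn B π ∧ isFullyComplementary N π) π∈
  ... | π∈allFuns , h = π∈allFuns , Equivalence.to Bool.T-∧ h

  ∈-partitions⁺ : ∀ {π} → π ∈ allFuns (box B) (upTo (suc (lastV N))) →
    T (isPartitionIn B π) → T (isFullyComplementary N π) → π ∈ partitions n
  ∈-partitions⁺ π∈ h₁ h₂ = ∈-filter⁺ (Bool.T? ∘ λ π → isPartitionIn B π ∧ isFullyComplementary N π) π∈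
    (Equivalence.from Bool.T-∧ (h₁ , h₂))

  partition-fullyComplementary : ∀ {π} → π ∈ partitions n → FullyComplementary n (Λ π)
  partition-fullyComplementary {π} π∈ = record { down = down ; disjoint = disjoint ; cover = cover }
    where
    isPartition : T (isPartitionIn B π)
    isPartition = proj₁ (proj₂ (∈-partitions⁻ π∈))

    isFC : ∀ {q} → q ∈□ N → T (all (λ I → all (λ J →
        (I ==ᵦ J) ∨ not (inDiagram π (ρ N I q) ∧ inDiagram π (ρ N J q))) E) E)
      × T (any (λ I → inDiagram π (ρ N I q)) E)
    isFC {q} q∈ = Equivalence.to Bool.T-∧ (T-all⁻ (proj₂ (proj₂ (∈-partitions⁻ π∈))) (∈-box⁺ q∈))

    down : ∀ {p q} → p ∈□ N → q ∈□ N → q ≤ᵥ p → Λ π p → Λ π q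
    down {p} {q} p∈ q∈ q≤p h = Λ⁺ π q (proj₁ (Pointwise-last q∈))
      (ℕ.≤-trans (Pointwise-last q≤p) (ℕ.≤-trans (Λ⁻ π p h)
        (antitone π (λ u∈ k → ℕ.≤ᵇ⇒≤ _ _ (T-all⁻ (T-all⁻ isPartition (∈-box⁺ u∈)) (∈-allFin k)))
          (Pointwise-init q∈) (Pointwise-init p∈) (Pointwise-init q≤p))))

    disjoint : ∀ {q I J} → q ∈□ N → evenSize I ≡ true → evenSize J ≡ true → Λ π (ρ N I q) → Λ π (ρ N J q) → I ≡ J
    disjoint {I = I} {J} q∈ evenI evenJ = exclusive⁻
      (T-all⁻ {xs = E} {J} (T-all⁻ {xs = E} {I} (proj₁ (isFC q∈)) (∈-evenSubsets⁺ evenI)) (∈-evenSubsets⁺ evenJ))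

    cover : ∀ {q} → q ∈□ N → ∃ λ I → evenSize I ≡ true × Λ π (ρ N I q)
    cover q∈ with find (Any.any⁻ _ E (proj₂ (isFC q∈)))
    ... | I , I∈ , h = I , ∈-evenSubsets⁻ I∈ , h

  partition-≤-last : ∀ {π u} → π ∈ partitions n → u ∈□ B → π u ≤ lastV N
  partition-≤-last π∈ u∈ =
    ℕ.≤-pred (∈-upTo⁻ (allFuns-value {ps = box B} (proj₁ (∈-partitions⁻ π∈)) (∈-box⁺ u∈)))

  -- A nonempty column of π has its top cell in the diagram; that cell also lies in the diagram of
  -- π', which bounds the entry there from below.
  Λ-⊆⇒≤ : ∀ {π π'} → π ∈ partitions n → (∀ {p} → p ∈□ N → Λ π p → Λ π' p) → ∀ {u} → u ∈□ B → π u ≤ π' u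
  Λ-⊆⇒≤ {π} {π'} π∈ sub {u} u∈ with π u in eq
  ... | zero = z≤n
  ... | suc k = subst₂ _≤_ (lastV-∷ʳ u (suc k)) (cong π' (initV-∷ʳ u (suc k)))
    (Λ⁻ π' (u ∷ʳ suc k) (sub (∈□-∷ʳ u∈ (s≤s z≤n , subst (_≤ lastV N) eq (partition-≤-last π∈ u∈)))
      (Λ⁺ π (u ∷ʳ suc k) (subst (1 ≤_) (sym (lastV-∷ʳ u (suc k))) (s≤s z≤n))
        (ℕ.≤-reflexive (trans (lastV-∷ʳ u (suc k)) (trans (sym eq) (cong π (sym (initV-∷ʳ u (suc k))))))))))

  -- The heights of the columns of D define the partition.
  realise : ∀ {D} → FullyComplementary n D → (∀ p → Dec (D p)) →
    ∃ λ π → π ∈ partitions n × (∀ {p} → p ∈□ N → (Λ π p → D p) × (D p → Λ π p))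
  realise {D} fc D? = f , ∈-partitions⁺ f∈ isPartition isFC , λ p∈ → Λ⇒D p∈ , D⇒Λ p∈
    where
    open FullyComplementary fc

    g : Vec ℕ d → ℕ
    g u = height (λ k → D? (u ∷ʳ k)) (lastV N)

    selected : ∃ λ f → f ∈ allFuns (box B) (upTo (suc (lastV N))) × (∀ {u} → u ∈ box B → f u ≡ g u)
    selected = allFuns-complete (box-unique B) g λ {u} _ → ∈-upTo⁺ (s≤s (height-≤ (λ k → D? (u ∷ʳ k)) (lastV N)))

    f : Vec ℕ d → ℕ
    f = proj₁ selected

    f∈ : f ∈ allFuns (box B) (upTo (suc (lastV N)))
    f∈ = proj₁ (proj₂ selected)

    f≡g : ∀ {u} → u ∈□ B → f u ≡ g u
    f≡g u∈ = proj₂ (proj₂ selected) (∈-box⁺ u∈)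

    column⇒D : ∀ {u k} → u ∈□ B → 1 ≤ k → k ≤ f u → D (u ∷ʳ k)
    column⇒D {u} {k} u∈ 1≤k k≤ rewrite f≡g u∈ = down
      (∈□-∷ʳ u∈ (ℕ.≤-trans 1≤k k≤ , height-≤ _ (lastV N)))
      (∈□-∷ʳ u∈ (1≤k , ℕ.≤-trans k≤ (height-≤ _ (lastV N))))
      (Pointwise-∷ʳ (ext λ _ → ℕ.≤-refl) k≤)
      (height-attained _ (lastV N) (ℕ.≤-trans 1≤k k≤))

    D⇒column : ∀ {u k} → u ∈□ B → k ≤ lastV N → D (u ∷ʳ k) → k ≤ f u
    D⇒column {u} u∈ k≤ Dk rewrite f≡g u∈ = height-maximal (λ k → D? (u ∷ʳ k)) (lastV N) Dk k≤

    Λ⇒D : ∀ {p} → p ∈□ N → Λ f p → D p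
    Λ⇒D {p} p∈ h = subst D (initV-∷ʳ-lastV p)
      (column⇒D (Pointwise-init p∈) (proj₁ (Pointwise-last p∈)) (Λ⁻ f p h))

    D⇒Λ : ∀ {p} → p ∈□ N → D p → Λ f p
    D⇒Λ {p} p∈ Dp = Λ⁺ f p (proj₁ (Pointwise-last p∈))
      (D⇒column (Pointwise-init p∈) (proj₂ (Pointwise-last p∈)) (subst D (sym (initV-∷ʳ-lastV p)) Dp))

    f≤ : ∀ {u} → u ∈□ B → f u ≤ lastV N
    f≤ u∈ rewrite f≡g u∈ = height-≤ _ (lastV N)

    step : ∀ {u} → u ∈□ B → ∀ k → f (zipWith _+_ u (unitV k)) ≤ f u
    step {u} u∈ k with ∈□? (zipWith _+_ u (unitV k)) B
    -- A unit step may leave the box, where enumerated functions are 0. Otherwise the top cell of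
    -- the next column moves down, at the same height, into this one.
    ... | no v∉ = subst (_≤ f u) (sym (allFuns-outside {ps = box B} f∈ (v∉ ∘ ∈-box⁻))) z≤n
    ... | yes v∈ with f (zipWith _+_ u (unitV k)) in eq
    ...   | zero = z≤n
    ...   | suc l = D⇒column u∈ l≤ (down (∈□-∷ʳ v∈ (s≤s z≤n , l≤)) (∈□-∷ʳ u∈ (s≤s z≤n , l≤))
      (Pointwise-∷ʳ (ext λ j → subst (lookup u j ≤_) (sym (Vec.lookup-zipWith _+_ j u (unitV k))) (ℕ.m≤m+n _ _)) ℕ.≤-refl)
      (column⇒D v∈ (s≤s z≤n) (ℕ.≤-reflexive (sym eq))))
      where
      l≤ : suc l ≤ lastV N
      l≤ = subst (_≤ lastV N) eq (f≤ v∈)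

    isPartition : T (isPartitionIn B f)
    isPartition = T-all⁺ {p = λ u → all (λ k → f (zipWith _+_ u (unitV k)) ℕ.≤ᵇ f u) (allFin d)} λ u∈ →
      T-all⁺ {xs = allFin d} λ {k} _ → ℕ.≤⇒≤ᵇ (step (∈-box⁻ u∈) k)

    isFC : T (isFullyComplementary N f)
    isFC = T-all⁺ {xs = box N} λ {q} q∈box → Equivalence.from Bool.T-∧
      ( (T-all⁺ λ {I} I∈ → T-all⁺ λ {J} J∈ → exclusive⁺ λ hI hJ → disjoint (∈-box⁻ q∈box)
          (∈-evenSubsets⁻ I∈) (∈-evenSubsets⁻ J∈)
          (Λ⇒D (ρ-∈□ I (∈-box⁻ q∈box)) hI) (Λ⇒D (ρ-∈□ J (∈-box⁻ q∈box)) hJ))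
      , covered q (∈-box⁻ q∈box))
      where
      covered : ∀ q → q ∈□ N → T (any (λ I → inDiagram f (ρ N I q)) E)
      covered q q∈ with cover q∈
      ... | I , even , DI = Any.any⁺ (λ I → inDiagram f (ρ N I q)) (lose {P = λ I → Λ f (ρ N I q)} (∈-evenSubsets⁺ even) (D⇒Λ (ρ-∈□ I q∈) DI))

  -- Surjectivity of the passage from partitions to colourings. Decidability of `c` is what makes
  -- the column heights computable.
  realise-colouring : ∀ {c} → Colouring n c → (∀ i x → Dec (c i x)) →
    ∃ λ π → π ∈ partitions n × (∀ {x} → x ∈□ n → ∀ j → (colour n (Λ π) j x → c j x) × (c j x → colour n (Λ π) j x))
  realise-colouring col c? with realise Coloured-fullyComplementary (Coloured? n c?)
    where open ColouringProperties col
  ... | π , π∈ , equiv = π , π∈ , λ x∈ j →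
      (λ h → colour-Coloured⁻ x∈ (proj₁ (equiv (ρ-∈□ ⁅ j ⁆ (∈□-double x∈))) h))
    , (λ h → proj₂ (equiv (ρ-∈□ ⁅ j ⁆ (∈□-double x∈))) (colour-Coloured⁺ x∈ h))
    where open ColouringProperties col

  partition-colouring : ∀ {π} → π ∈ partitions n → Colouring n (colour n (Λ π))
  partition-colouring π∈ = FullyComplementaryProperties.colouring (partition-fullyComplementary π∈) zero

  -- Injectivity of the passage from partitions to colourings, in the negative form that `length-≤`
  -- asks for.
  same-colours : ∀ {π π'} → π ∈ partitions n → π' ∈ partitions n →
    (∀ {x} → x ∈□ n → ∀ j → colour n (Λ π) j x → colour n (Λ π') j x) →
    (∀ {x} → x ∈□ n → ∀ j → colour n (Λ π') j x → colour n (Λ π) j x) →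
    ¬ DifferOn (box B) π π'
  same-colours π∈ π'∈ to from (u , u∈ , π≢π') = π≢π' (ℕ.≤-antisym
    (Λ-⊆⇒≤ π∈ (colour-determines fc fc' (λ j x∈ → to x∈ j)) (∈-box⁻ u∈))
    (Λ-⊆⇒≤ π'∈ (colour-determines fc' fc (λ j x∈ → from x∈ j)) (∈-box⁻ u∈)))
    where
    fc = partition-fullyComplementary π∈
    fc' = partition-fullyComplementary π'∈

  partitions-distinct : AllPairs (DifferOn (box B)) (partitions n)
  partitions-distinct = AllPairs.filter⁺ (Bool.T? ∘ λ π → isPartitionIn B π ∧ isFullyComplementary N π)
    (allFuns-distinct (box-unique B) (Unique.upTo⁺ (suc (lastV N))))

-- The recurrence

lower : ∀ {m} → Vec ℕ m → Fin m → Vec ℕ m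
lower n i = updateAt n i ℕ.pred

lookup-lower : ∀ {m} (n : Vec ℕ m) i → lookup (lower n i) i ≡ ℕ.pred (lookup n i)
lookup-lower n i = Vec.lookup∘updateAt i n

lookup-lower-≢ : ∀ {m} (n : Vec ℕ m) {i j} → j ≢ i → lookup (lower n i) j ≡ lookup n j
lookup-lower-≢ n {i} {j} j≢i = Vec.lookup∘updateAt′ j i j≢i n

lower-⊆ : ∀ {m} {n x : Vec ℕ m} i → x ∈□ lower n i → x ∈□ n
lower-⊆ {n = n} {x} i x∈ = ext λ j → proj₁ (app x∈ j) , ℕ.≤-trans (proj₂ (app x∈ j)) (bound j)
  where
  bound : ∀ j → lookup (lower n i) j ≤ lookup n j
  bound j with j Fin.≟ i
  ... | yes refl = ℕ.≤-trans (ℕ.≤-reflexive (lookup-lower n j)) ℕ.pred[n]≤n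
  ... | no j≢i = ℕ.≤-reflexive (lookup-lower-≢ n j≢i)

∈□-lower : ∀ {m} {n x : Vec ℕ m} {i} → x ∈□ n → lookup x i ≢ lookup n i → x ∈□ lower n i
∈□-lower {n = n} {x} {i} x∈ x≢n = ext λ j → proj₁ (app x∈ j) , bound j
  where
  bound : ∀ j → lookup x j ≤ lookup (lower n i) j
  bound j with j Fin.≟ i
  ... | yes refl = subst (lookup x j ≤_) (sym (lookup-lower n j)) (ℕ.<⇒≤pred (ℕ.≤∧≢⇒< (proj₂ (app x∈ j)) x≢n))
  ... | no j≢i = subst (lookup x j ≤_) (sym (lookup-lower-≢ n j≢i)) (proj₂ (app x∈ j))

lower-≢ : ∀ {m} {n x : Vec ℕ m} {i} → x ∈□ lower n i → lookup x i ≢ lookup n i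
lower-≢ {n = n} {x} {i} x∈ eq with app x∈ i
... | 1≤x , x≤ rewrite lookup-lower n i | eq = ℕ.<⇒≱ (pred< 1≤x) x≤
  where
  pred< : ∀ {a} → 1 ≤ a → ℕ.pred a < a
  pred< {suc a} _ = ℕ.≤-refl

Colouring-lower : ∀ {m} {n : Vec ℕ m} {c} i → Colouring n c → Colouring (lower n i) c
Colouring-lower i col = record
  { total = λ x∈ → total (lower-⊆ i x∈)
  ; unique = λ x∈ → unique (lower-⊆ i x∈)
  ; mono = λ x∈ z∈ → mono (lower-⊆ i x∈) (lower-⊆ i z∈)
  }
  where open Colouring col

module _ {m : ℕ} {n : Vec ℕ m} (i : Fin m) (c : Fin m → Vec ℕ m → Set) where

  -- Undoes the deletion of the face x_i = n_i: the face receives colour i whatever `c` says there,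
  -- and carrying the inequality in the other case keeps colours unique.
  extend : Fin m → Vec ℕ m → Set
  extend j x = lookup x i ≡ lookup n i × j ≡ i ⊎ lookup x i ≢ lookup n i × c j x

  extend? : (∀ j x → Dec (c j x)) → ∀ j x → Dec (extend j x)
  extend? c? j x = (lookup x i ℕ.≟ lookup n i) ×-dec (j Fin.≟ i) ⊎-dec ¬? (lookup x i ℕ.≟ lookup n i) ×-dec c? j x

  Colouring-extend : Colouring (lower n i) c → Colouring n extend
  Colouring-extend col = record { total = total′ ; unique = unique′ ; mono = mono′ }
    where
    open Colouring col

    total′ : ∀ {x} → x ∈□ n → ∃ λ j → extend j x
    total′ {x} x∈ with lookup x i ℕ.≟ lookup n i
    ... | yes eq = i , inj₁ (eq , refl)
    ... | no ≢ with total (∈□-lower x∈ ≢)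
    ...   | j , cj = j , inj₂ (≢ , cj)

    unique′ : ∀ {x j k} → x ∈□ n → extend j x → extend k x → j ≡ k
    unique′ x∈ (inj₁ (_ , j≡i)) (inj₁ (_ , k≡i)) = trans j≡i (sym k≡i)
    unique′ x∈ (inj₁ (eq , _)) (inj₂ (≢ , _)) = contradiction eq ≢
    unique′ x∈ (inj₂ (≢ , _)) (inj₁ (eq , _)) = contradiction eq ≢
    unique′ x∈ (inj₂ (≢ , cj)) (inj₂ (_ , ck)) = unique (∈□-lower x∈ ≢) cj ck

    mono′ : ∀ {x z j} → x ∈□ n → z ∈□ n → lookup x j ≤ lookup z j →
      (∀ k → k ≢ j → lookup z k ≤ lookup x k) → extend j x → extend j z
    -- On the face, coordinate i is already maximal and can only increase, so z stays on it.
    mono′ x∈ z∈ x≤z z≤x (inj₁ (eq , refl)) =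
      inj₁ (ℕ.≤-antisym (proj₂ (app z∈ i)) (ℕ.≤-trans (ℕ.≤-reflexive (sym eq)) x≤z) , refl)
    mono′ {x} {z} {j} x∈ z∈ x≤z z≤x (inj₂ (≢ , cj)) with lookup z i ℕ.≟ lookup n i | i Fin.≟ j
    -- Here z is on the face and x is not, so coordinate i has grown. This is allowed only for j =
    -- i, and then z has the colour of the face.
    ... | yes eq | yes refl = inj₁ (eq , refl)
    ... | yes eq | no i≢j = contradiction
      (ℕ.≤-antisym (proj₂ (app x∈ i)) (ℕ.≤-trans (ℕ.≤-reflexive (sym eq)) (z≤x i i≢j))) ≢
    ... | no ≢′ | _ = inj₂ (≢′ , mono (∈□-lower x∈ ≢) (∈□-lower z∈ ≢′) x≤z z≤x cj)

module _ {d : ℕ} (n : Vec ℕ (suc d)) (n>0 : ∀ j → 1 ≤ lookup n j) where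

  private
    corner∈ : n ∈□ n
    corner∈ = ext λ j → n>0 j , ℕ.≤-refl

    Tagged : Set
    Tagged = Fin (suc d) × (Vec ℕ d → ℕ)

    tagged : Fin (suc d) → List Tagged
    tagged i = map (i ,_) (partitions (lower n i))

    allTagged : List Tagged
    allTagged = concatMap tagged (allFin (suc d))

    ∈-allTagged⁻ : ∀ {i π} → (i , π) ∈ allTagged → π ∈ partitions (lower n i)
    ∈-allTagged⁻ h with ∈-concatMap-elim (allFin (suc d)) h
    ... | j , _ , h′ with ∈-map⁻ (j ,_) h′
    ...   | _ , π∈ , refl = π∈

    -- The corner n has some colour i, which then fills the whole face x_i = n_i; what remains is a
    -- colouring of the box of lower n i.
    record Peels (π : Vec ℕ d → ℕ) (t : Tagged) : Set where
      field
        face : ∀ {x} → x ∈□ n → lookup x (proj₁ t) ≡ lookup n (proj₁ t) → colour n (Λ π) (proj₁ t) x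
        to : ∀ {x} → x ∈□ lower n (proj₁ t) → ∀ j → colour n (Λ π) j x → colour (lower n (proj₁ t)) (Λ (proj₂ t)) j x
        from : ∀ {x} → x ∈□ lower n (proj₁ t) → ∀ j → colour (lower n (proj₁ t)) (Λ (proj₂ t)) j x → colour n (Λ π) j x
    open Peels

    Λ-colour? : ∀ {m} (n : Vec ℕ (suc m)) π j x → Dec (colour n (Λ π) j x)
    Λ-colour? n π j x = Bool.T? (inDiagram π (ρ (double n) ⁅ j ⁆ x))

    peel : ∀ {π} → π ∈ partitions n → ∃ λ t → t ∈ allTagged × Peels π t
    peel {π} π∈ with Colouring.total (partition-colouring π∈) corner∈
    ... | i , ci with realise-colouring (Colouring-lower i (partition-colouring π∈)) (Λ-colour? n π)
    ...   | π' , π'∈ , equiv = (i , π') , ∈-concatMap-intro (∈-allFin i) (∈-map⁺ (i ,_) π'∈) , record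
      -- Passing from the corner to x on the face keeps coordinate i and lowers the others, so
      -- colour i persists.
      { face = λ {x} x∈ eq → Colouring.mono (partition-colouring π∈) corner∈ x∈
          (ℕ.≤-reflexive (sym eq)) (λ j _ → proj₂ (app x∈ j)) ci
      ; to = λ x∈ j → proj₂ (equiv x∈ j)
      ; from = λ x∈ j → proj₁ (equiv x∈ j)
      }

    unpeel : ∀ {t} → t ∈ allTagged → ∃ λ π → π ∈ partitions n × Peels π t
    unpeel {i , π'} t∈ with realise-colouring (Colouring-extend i (colour (lower n i) (Λ π'))
                               (partition-colouring (∈-allTagged⁻ t∈)))
                               (extend? {n = n} i _ (Λ-colour? (lower n i) π'))
    ... | π , π∈ , equiv = π , π∈ , record
      { face = λ x∈ eq → proj₂ (equiv x∈ i) (inj₁ (eq , refl))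
      ; to = λ {x} x∈ j h → inner x∈ (proj₁ (equiv (lower-⊆ i x∈) j) h)
      ; from = λ x∈ j h → proj₂ (equiv (lower-⊆ i x∈) j) (inj₂ (lower-≢ {n = n} x∈ , h))
      }
      where
      inner : ∀ {x j} → x ∈□ lower n i → extend {n = n} i (colour (lower n i) (Λ π')) j x →
        colour (lower n i) (Λ π') j x
      inner x∈ (inj₁ (eq , _)) = contradiction eq (lower-≢ {n = n} x∈)
      inner x∈ (inj₂ (_ , h)) = h

    peel-colours : ∀ {π₁ π₂ t} → π₁ ∈ partitions n → Peels π₁ t → Peels π₂ t →
      ∀ {x} → x ∈□ n → ∀ j → colour n (Λ π₁) j x → colour n (Λ π₂) j x
    peel-colours {π₁} {π₂} {i , _} π₁∈ r₁ r₂ {x} x∈ j h with lookup x i ℕ.≟ lookup n i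
    ... | yes eq = subst (λ k → colour n (Λ π₂) k x)
      (Colouring.unique (partition-colouring π₁∈) x∈ (face r₁ x∈ eq) h) (face r₂ x∈ eq)
    ... | no ≢ = from r₂ (∈□-lower x∈ ≢) j (to r₁ (∈□-lower x∈ ≢) j h)

    -- The implication holds vacuously for distinct tags, whose arrays live on different boxes and
    -- are not to be compared.
    TaggedDiffer : Tagged → Tagged → Set
    TaggedDiffer (i , π₁) (j , π₂) = i ≡ j → DifferOn (box (initV (double (lower n i)))) π₁ π₂

    allTagged-distinct : AllPairs TaggedDiffer allTagged
    allTagged-distinct = AllPairs-concatMap (Unique.allFin⁺ (suc d))
      (λ {i} _ → AllPairs.map⁺ (AllPairs.map (λ h _ → h) (partitions-distinct {n = lower n i})))
      (λ {i} {j} i≢j s∈ t∈ i≡j → contradiction (trans (sym (tag s∈)) (trans i≡j (tag t∈))) i≢j)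
      where
      tag : ∀ {i t} → t ∈ tagged i → proj₁ t ≡ i
      tag {i} t∈ with ∈-map⁻ (i ,_) t∈
      ... | _ , _ , refl = refl

    -- The tag is the colour of the corner, so both tags agree; then both arrays have the colours of
    -- π on the lowered box.
    peel-unique : ∀ {π s t} → s ∈ allTagged → t ∈ allTagged → π ∈ partitions n →
      Peels π s → Peels π t → ¬ TaggedDiffer s t
    peel-unique {s = i , π₁} {j , π₂} s∈ t∈ π∈ r₁ r₂ differ
      with Colouring.unique (partition-colouring π∈) corner∈ (face r₁ corner∈ refl) (face r₂ corner∈ refl)
    ... | refl = same-colours (∈-allTagged⁻ s∈) (∈-allTagged⁻ t∈)
      (λ x∈ k h → to r₂ x∈ k (from r₁ x∈ k h)) (λ x∈ k h → to r₁ x∈ k (from r₂ x∈ k h)) (differ refl)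

  -- `Peels` is total and injective in each direction, so each direction yields one inequality.
  partitions-recurrence : length (partitions n) ≡
    List.foldr (λ i s → length (partitions (lower n i)) + s) 0 (allFin (suc d))
  partitions-recurrence = begin
    length (partitions n) ≡⟨ ℕ.≤-antisym
      (length-≤ (partitions-distinct {n = n}) peel λ π₁∈ π₂∈ _ r₁ r₂ →
        same-colours π₁∈ π₂∈ (peel-colours π₁∈ r₁ r₂) (peel-colours π₂∈ r₂ r₁))
      (length-≤ {R = λ t π → Peels π t} allTagged-distinct unpeel peel-unique) ⟩
    length allTagged ≡⟨ length-concatMap {f = tagged} (allFin (suc d)) ⟩
    List.foldr (λ i s → length (tagged i) + s) 0 (allFin (suc d))
      ≡⟨ List.foldr-cong (λ i s → cong (_+ s) (List.length-map (i ,_) (partitions (lower n i)))) refl (allFin (suc d)) ⟩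
    List.foldr (λ i s → length (partitions (lower n i)) + s) 0 (allFin (suc d)) ∎
    where open ≡-Reasoning

-- Vectors with zero components and the boundary convention

zeros-positive : ∀ {m} (n : Vec ℕ m) → zeros n ≡ 0 → ∀ j → 1 ≤ lookup n j
zeros-positive (suc _ ∷ n) z zero = s≤s z≤n
zeros-positive (suc _ ∷ n) z (suc j) = zeros-positive n z j

zeros-lower : ∀ {m} (n : Vec ℕ m) i → zeros n ≡ 0 → zeros (lower n i) ≡ 0 ⊎ zeros (lower n i) ≡ 1
zeros-lower (suc zero ∷ n) zero z = inj₂ (cong suc z)
zeros-lower (suc (suc _) ∷ n) zero z = inj₁ z
zeros-lower (suc _ ∷ n) (suc i) z = zeros-lower n i z

zeros-empty : ∀ {m} {n x : Vec ℕ m} {k} → zeros n ≡ suc k → ¬ x ∈□ n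
zeros-empty {n = zero ∷ n} {a ∷ x} z x∈ = ℕ.<⇒≱ (proj₁ (app x∈ zero)) (proj₂ (app x∈ zero))
zeros-empty {n = suc _ ∷ n} {a ∷ x} z x∈ = zeros-empty z (tail⁺ x∈)

-- The box of n is empty, so it has exactly one colouring.
length-partitions-empty : ∀ {d} (n : Vec ℕ (suc d)) → zeros n ≡ 1 → length (partitions n) ≡ 1
length-partitions-empty n z = ℕ.≤-antisym
  (length-≤ {R = λ _ (_ : ⊤) → ⊤} {ys = tt ∷ []} (partitions-distinct {n = n}) (λ _ → tt , here refl , tt)
    λ π₁∈ π₂∈ _ _ _ → same-colours {n = n} π₁∈ π₂∈ (λ x∈ → contradiction x∈ (zeros-empty z)) (λ x∈ → contradiction x∈ (zeros-empty z)))
  (nonempty (proj₁ (proj₂ (realise-colouring {n = n} {c = λ _ _ → ⊤}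
    (record { total = λ x∈ → contradiction x∈ (zeros-empty z)
            ; unique = λ x∈ → contradiction x∈ (zeros-empty z)
            ; mono = λ _ _ _ _ _ → tt })
    (λ _ _ → yes tt)))))
  where
  nonempty : ∀ {A : Set} {x : A} {xs} → x ∈ xs → 1 ≤ length xs
  nonempty {xs = _ ∷ _} _ = s≤s z≤n

-- With two or more zeros the empty box would still have one colouring while the convention counts
-- 0, so the hypothesis stops at one zero. Lowering a positive vector never goes beyond that.
fcpCount-partitions : ∀ {d} (n : Vec ℕ (suc d)) → zeros n ≡ 0 ⊎ zeros n ≡ 1 → fcpCount n ≡ length (partitions n)
fcpCount-partitions n h with zeros n in eq
... | zero = refl
fcpCount-partitions n (inj₂ refl) | suc zero = sym (length-partitions-empty n eq)

fcpCount-recurrence : ∀ {d} (n : Vec ℕ (suc d)) → zeros n ≡ 0 →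
  fcpCount n ≡ List.foldr (λ i s → fcpCount (lower n i) + s) 0 (allFin (suc d))
fcpCount-recurrence n z = trans (fcpCount-partitions n (inj₁ z)) (trans
  (partitions-recurrence n (zeros-positive n z))
  (List.foldr-cong (λ i s → cong (_+ s) (sym (fcpCount-partitions (lower n i) (zeros-lower n i z)))) refl (allFin _)))

-- Laurent polynomials acting on series

module _ {A : Set} where

  sumOver : List A → (A → ℤ) → ℤ
  sumOver xs f = List.foldr (λ a s → f a ℤ.+ s) (+ 0) xs

  sumOver-cong : ∀ {f g : A → ℤ} → (∀ a → f a ≡ g a) → ∀ xs → sumOver xs f ≡ sumOver xs g
  sumOver-cong h = List.foldr-cong (λ a s → cong (ℤ._+ s) (h a)) refl

  sumOver-+ : ∀ (f g : A → ℤ) xs → sumOver xs (λ a → f a ℤ.+ g a) ≡ sumOver xs f ℤ.+ sumOver xs g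
  sumOver-+ f g [] = refl
  sumOver-+ f g (x ∷ xs) rewrite sumOver-+ f g xs = rearrange (f x) (g x) _ _
    where
    rearrange : ∀ a b s t → (a ℤ.+ b) ℤ.+ (s ℤ.+ t) ≡ (a ℤ.+ s) ℤ.+ (b ℤ.+ t)
    rearrange = solve-∀

  sumOver-neg : ∀ (f : A → ℤ) xs → sumOver xs (λ a → ℤ.- f a) ≡ ℤ.- sumOver xs f
  sumOver-neg f [] = refl
  sumOver-neg f (x ∷ xs) rewrite sumOver-neg f xs = sym (ℤ.neg-distrib-+ (f x) _)

  sumOver-minus : ∀ (f g : A → ℤ) xs → sumOver xs (λ a → f a ℤ.- g a) ≡ sumOver xs f ℤ.- sumOver xs g
  sumOver-minus f g xs = trans (sumOver-+ f (λ a → ℤ.- g a) xs) (cong (λ s → sumOver xs f ℤ.+ s) (sumOver-neg g xs))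

  sumOver-* : ∀ k (f : A → ℤ) xs → sumOver xs (λ a → k ℤ.* f a) ≡ k ℤ.* sumOver xs f
  sumOver-* k f [] = sym (ℤ.*-zeroʳ k)
  sumOver-* k f (x ∷ xs) rewrite sumOver-* k f xs = sym (ℤ.*-distribˡ-+ k (f x) _)

sumOver-map : ∀ {A B : Set} (g : B → A) (f : A → ℤ) xs → sumOver (map g xs) f ≡ sumOver xs (f ∘ g)
sumOver-map g f [] = refl
sumOver-map g f (x ∷ xs) = cong (λ s → f (g x) ℤ.+ s) (sumOver-map g f xs)

allFin-suc : ∀ m → allFin (suc m) ≡ zero ∷ map suc (allFin m)
allFin-suc m = cong (zero ∷_) (sym (List.map-tabulate (λ i → i) suc))

sumOver-allFin-suc : ∀ {m} (f : Fin (suc m) → ℤ) → sumOver (allFin (suc m)) f ≡ f zero ℤ.+ sumOver (allFin m) (f ∘ suc)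
sumOver-allFin-suc {m} f = trans (cong (λ xs → sumOver xs f) (allFin-suc m))
  (cong (λ s → f zero ℤ.+ s) (sumOver-map suc f (allFin m)))

sumOver-const : ∀ m c → sumOver (allFin m) (λ _ → c) ≡ + m ℤ.* c
sumOver-const zero c = sym (ℤ.*-zeroˡ c)
sumOver-const (suc m) c = trans (sumOver-allFin-suc {m} (λ _ → c))
  (trans (cong (λ s → c ℤ.+ s) (sumOver-const m c)) (sym (ℤ.suc-* (+ m) c)))

infixl 6 _⊖_

_⊖_ : ∀ {m} → Vec ℤ m → Vec ℤ m → Vec ℤ m
_⊖_ = zipWith ℤ._-_

⊖-+ : ∀ {m} (e v w : Vec ℤ m) → e ⊖ zipWith ℤ._+_ v w ≡ (e ⊖ v) ⊖ w
⊖-+ [] [] [] = refl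
⊖-+ (a ∷ e) (b ∷ v) (c ∷ w) = cong₂ _∷_ (assoc a b c) (⊖-+ e v w)
  where
  assoc : ∀ a b c → a ℤ.- (b ℤ.+ c) ≡ (a ℤ.- b) ℤ.- c
  assoc = solve-∀

⊖-comm : ∀ {m} (e v w : Vec ℤ m) → (e ⊖ v) ⊖ w ≡ (e ⊖ w) ⊖ v
⊖-comm e v w = trans (sym (⊖-+ e v w)) (trans (cong (e ⊖_) (Vec.zipWith-comm ℤ.+-comm v w)) (⊖-+ e w v))

⊖-zero : ∀ {m} (e : Vec ℤ m) → e ⊖ replicate m (+ 0) ≡ e
⊖-zero = Vec.zipWith-identityʳ ℤ.+-identityʳ

-- Multiplying a series by x_i^a reads its coefficient at e - a e_i, hence the subtraction.
shift : ∀ {m} → Fin m → ℤ → Vec ℤ m → Vec ℤ m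
shift i a e = updateAt e i (ℤ._- a)

⊖-varPow : ∀ {m} (e : Vec ℤ m) i a → e ⊖ updateAt (replicate m (+ 0)) i (λ _ → a) ≡ shift i a e
⊖-varPow (b ∷ e) zero a = cong (b ℤ.- a ∷_) (⊖-zero e)
⊖-varPow (b ∷ e) (suc i) a = cong₂ _∷_ (ℤ.+-identityʳ b) (⊖-varPow e i a)

infix 4 _≐_

_≐_ : ∀ {m} → Series m → Series m → Set
F ≐ G = ∀ e → F e ≡ G e

module _ {m : ℕ} where

  ⊛-cong : ∀ (P : LPoly m) {F G} → F ≐ G → P ⊛ F ≐ P ⊛ G
  ⊛-cong [] h e = refl
  ⊛-cong ((c , v) ∷ P) h e = cong₂ (λ a b → c ℤ.* a ℤ.+ b) (h (e ⊖ v)) (⊛-cong P h e)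

  ⊛-++ : ∀ (P Q : LPoly m) F e → ((P ++ Q) ⊛ F) e ≡ (P ⊛ F) e ℤ.+ (Q ⊛ F) e
  ⊛-++ [] Q F e = sym (ℤ.+-identityˡ _)
  ⊛-++ ((c , v) ∷ P) Q F e rewrite ⊛-++ P Q F e = sym (ℤ.+-assoc (c ℤ.* F (e ⊖ v)) _ _)

  ⊛-neg : ∀ (P : LPoly m) F e → ((-ₚ P) ⊛ F) e ≡ ℤ.- (P ⊛ F) e
  ⊛-neg [] F e = refl
  ⊛-neg ((c , v) ∷ P) F e rewrite ⊛-neg P F e = rearrange c (F (e ⊖ v)) _
    where
    rearrange : ∀ c x y → ℤ.- c ℤ.* x ℤ.+ ℤ.- y ≡ ℤ.- (c ℤ.* x ℤ.+ y)
    rearrange = solve-∀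

  ⊛-minus : ∀ (P Q : LPoly m) F e → ((P -ₚ Q) ⊛ F) e ≡ (P ⊛ F) e ℤ.- (Q ⊛ F) e
  ⊛-minus P Q F e = trans (⊛-++ P (-ₚ Q) F e) (cong (λ s → (P ⊛ F) e ℤ.+ s) (⊛-neg Q F e))

  ⊛-monomial : ∀ c v (Q : LPoly m) F e →
    (map (λ t → c ℤ.* proj₁ t , zipWith ℤ._+_ v (proj₂ t)) Q ⊛ F) e ≡ c ℤ.* (Q ⊛ F) (e ⊖ v)
  ⊛-monomial c v [] F e = sym (ℤ.*-zeroʳ c)
  ⊛-monomial c v ((b , w) ∷ Q) F e rewrite ⊛-monomial c v Q F e | ⊖-+ e v w = rearrange c b (F ((e ⊖ v) ⊖ w)) _
    where
    rearrange : ∀ c b x y → c ℤ.* b ℤ.* x ℤ.+ c ℤ.* y ≡ c ℤ.* (b ℤ.* x ℤ.+ y)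
    rearrange = solve-∀

  ⊛-* : ∀ (P Q : LPoly m) F → (P *ₚ Q) ⊛ F ≐ P ⊛ (Q ⊛ F)
  ⊛-* [] Q F e = refl
  ⊛-* ((c , v) ∷ P) Q F e = trans (⊛-++ (map _ Q) (P *ₚ Q) F e)
    (cong₂ ℤ._+_ (⊛-monomial c v Q F e) (⊛-* P Q F e))

  ⊛-zero : ∀ (P : LPoly m) e → (P ⊛ λ _ → + 0) e ≡ + 0
  ⊛-zero [] e = refl
  ⊛-zero ((c , v) ∷ P) e rewrite ⊛-zero P e | ℤ.*-zeroʳ c = refl

  -- The induction step of `⊛-comm`: the leading monomial c x^v of the other polynomial is carried
  -- past `Q`, and `G` holds the remaining terms.
  ⊛-shift-linear : ∀ (Q : LPoly m) c v F G e →
    (Q ⊛ λ e′ → c ℤ.* F (e′ ⊖ v) ℤ.+ G e′) e ≡ c ℤ.* (Q ⊛ F) (e ⊖ v) ℤ.+ (Q ⊛ G) e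
  ⊛-shift-linear [] c v F G e = sym (trans (ℤ.+-identityʳ _) (ℤ.*-zeroʳ c))
  ⊛-shift-linear ((b , w) ∷ Q) c v F G e
    rewrite ⊛-shift-linear Q c v F G e | ⊖-comm e w v = rearrange b c (F ((e ⊖ v) ⊖ w)) (G (e ⊖ w)) _ _
    where
    rearrange : ∀ b c x y s t → b ℤ.* (c ℤ.* x ℤ.+ y) ℤ.+ (c ℤ.* s ℤ.+ t) ≡ c ℤ.* (b ℤ.* x ℤ.+ s) ℤ.+ (b ℤ.* y ℤ.+ t)
    rearrange = solve-∀

  ⊛-comm : ∀ (P Q : LPoly m) F → P ⊛ (Q ⊛ F) ≐ Q ⊛ (P ⊛ F)
  ⊛-comm [] Q F e = sym (⊛-zero Q e)
  ⊛-comm ((c , v) ∷ P) Q F e = trans (cong (λ s → c ℤ.* (Q ⊛ F) (e ⊖ v) ℤ.+ s) (⊛-comm P Q F e))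
    (sym (⊛-shift-linear Q c v F (P ⊛ F) e))

  ⊛-const : ∀ c (F : Series m) e → (constₚ c ⊛ F) e ≡ c ℤ.* F e
  ⊛-const c F e rewrite ⊖-zero e = ℤ.+-identityʳ _

  ⊛-varPow : ∀ i a (F : Series m) e → (varPow i a ⊛ F) e ≡ F (shift i a e)
  ⊛-varPow i a F e rewrite ⊖-varPow e i a = trans (ℤ.+-identityʳ _) (ℤ.*-identityˡ _)

  ⊛-sum : ∀ {A : Set} (xs : List A) (f : A → LPoly m) F e → (sumₚ xs f ⊛ F) e ≡ sumOver xs (λ a → (f a ⊛ F) e)
  ⊛-sum [] f F e = refl
  ⊛-sum (x ∷ xs) f F e = trans (⊛-++ (f x) (sumₚ xs f) F e) (cong (λ s → (f x ⊛ F) e ℤ.+ s) (⊛-sum xs f F e))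

-- Products of one-variable series

tensor : ∀ {m} → Vec (ℤ → ℤ) m → Series m
tensor [] [] = + 1
tensor (f ∷ fs) (a ∷ e) = f a ℤ.* tensor fs e

-- Multiplication by x and by 1 - x on series in one variable.
translate difference : (ℤ → ℤ) → ℤ → ℤ
translate f x = f (x ℤ.- + 1)
difference f x = f x ℤ.- f (x ℤ.- + 1)

tensor-translate : ∀ {m} (fs : Vec (ℤ → ℤ) m) i → var i ⊛ tensor fs ≐ tensor (updateAt fs i translate)
tensor-translate fs i e = trans (⊛-varPow i (+ 1) (tensor fs) e) (go fs i e)
  where
  go : ∀ {m} (fs : Vec (ℤ → ℤ) m) i e → tensor fs (shift i (+ 1) e) ≡ tensor (updateAt fs i translate) e
  go (f ∷ fs) zero (a ∷ e) = refl
  go (f ∷ fs) (suc i) (a ∷ e) = cong (λ s → f a ℤ.* s) (go fs i e)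

tensor-difference : ∀ {m} (fs : Vec (ℤ → ℤ) m) i →
  (constₚ (+ 1) -ₚ var i) ⊛ tensor fs ≐ tensor (updateAt fs i difference)
tensor-difference fs i e = trans (⊛-minus (constₚ (+ 1)) (var i) (tensor fs) e)
  (trans (cong₂ ℤ._-_ (trans (⊛-const (+ 1) (tensor fs) e) (ℤ.*-identityˡ _)) (⊛-varPow i (+ 1) (tensor fs) e))
    (go fs i e))
  where
  go : ∀ {m} (fs : Vec (ℤ → ℤ) m) i e →
    tensor fs e ℤ.- tensor fs (shift i (+ 1) e) ≡ tensor (updateAt fs i difference) e
  go (f ∷ fs) zero (a ∷ e) = factor (f a) (f (a ℤ.- + 1)) (tensor fs e)
    where
    factor : ∀ x y t → x ℤ.* t ℤ.- y ℤ.* t ≡ (x ℤ.- y) ℤ.* t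
    factor = solve-∀
  go (f ∷ fs) (suc i) (a ∷ e) = trans (factor (f a) (tensor fs e) (tensor fs (shift i (+ 1) e)))
    (cong (λ s → f a ℤ.* s) (go fs i e))
    where
    factor : ∀ x s t → x ℤ.* s ℤ.- x ℤ.* t ≡ x ℤ.* (s ℤ.- t)
    factor = solve-∀

module _ (op : (ℤ → ℤ) → ℤ → ℤ) where

  private
    applyAt : ∀ {m} → Fin m → Vec (ℤ → ℤ) m → Vec (ℤ → ℤ) m
    applyAt i fs = updateAt fs i op

  applyAt-suc : ∀ {m} f (fs : Vec (ℤ → ℤ) m) xs →
    List.foldr applyAt (f ∷ fs) (map suc xs) ≡ f ∷ List.foldr applyAt fs xs
  applyAt-suc f fs [] = refl
  applyAt-suc f fs (x ∷ xs) rewrite applyAt-suc f fs xs = refl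

  applyAt-allFin : ∀ {m} (fs : Vec (ℤ → ℤ) m) → List.foldr applyAt fs (allFin m) ≡ Vec.map op fs
  applyAt-allFin [] = refl
  applyAt-allFin {suc m} (f ∷ fs) = trans (cong (List.foldr applyAt (f ∷ fs)) (allFin-suc m))
    (trans (cong (applyAt zero) (applyAt-suc f fs (allFin m))) (cong (op f ∷_) (applyAt-allFin fs)))

  -- `P i` acts on the i-th entry alone, so the product over all i applies `op` once to every entry.
  tensor-prod : ∀ {m} (P : Fin m → LPoly m) → (∀ fs i → P i ⊛ tensor fs ≐ tensor (updateAt fs i op)) →
    ∀ fs → prodₚ (allFin m) P ⊛ tensor fs ≐ tensor (Vec.map op fs)
  tensor-prod {m} P h fs e = trans (go (allFin m) e) (cong (λ gs → tensor gs e) (applyAt-allFin fs))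
    where
    go : ∀ xs → prodₚ xs P ⊛ tensor fs ≐ tensor (List.foldr applyAt fs xs)
    go [] e = trans (⊛-const (+ 1) (tensor fs) e) (ℤ.*-identityˡ _)
    go (x ∷ xs) e = trans (⊛-* (P x) (prodₚ xs P) (tensor fs) e) (trans (⊛-cong (P x) (go xs) e) (h (List.foldr applyAt fs xs) x e))

-- The one-variable series 1 and x/(1 - x). Their products over all variables are the series 1,
-- called `δ`, and p, called `positive`.
[=0] [>0] : ℤ → ℤ
[=0] (+ 0) = + 1
[=0] _ = + 0
[>0] (+ suc _) = + 1
[>0] _ = + 0

δ positive : ∀ {m} → Series m
δ {m} = tensor (replicate m [=0])
positive {m} = tensor (replicate m [>0])

difference-[>0] : ∀ x → difference [>0] x ≡ translate [=0] x
difference-[>0] (+ 0) = refl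
difference-[>0] (+ 1) = refl
difference-[>0] (+ suc (suc k)) = refl
difference-[>0] -[1+ k ] = refl

prod-positive : ∀ {m} → prodₚ (allFin m) (λ i → constₚ (+ 1) -ₚ var i) ⊛ positive ≐ prodₚ (allFin m) var ⊛ δ
prod-positive {m} e = trans (tensor-prod difference (λ i → constₚ (+ 1) -ₚ var i) tensor-difference (replicate m [>0]) e)
  (trans (go e) (sym (tensor-prod translate var tensor-translate (replicate m [=0]) e)))
  where
  go : ∀ {m} → tensor (Vec.map difference (replicate m [>0])) ≐ tensor (Vec.map translate (replicate m [=0]))
  go [] = refl
  go (a ∷ e) = cong₂ ℤ._*_ (difference-[>0] a) (go e)

δ-self : ∀ {m} (e : Vec ℤ m) → δ (e ⊖ e) ≡ + 1
δ-self [] = refl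
δ-self (a ∷ e) rewrite ℤ.+-inverseʳ a | δ-self e = refl

[=0]-≢ : ∀ {a} → a ≢ + 0 → [=0] a ≡ + 0
[=0]-≢ {+ 0} h = contradiction refl h
[=0]-≢ {+ suc _} h = refl
[=0]-≢ { -[1+ _ ]} h = refl

δ-≢ : ∀ {m} (v e : Vec ℤ m) → v ≢ e → δ (e ⊖ v) ≡ + 0
δ-≢ [] [] h = contradiction refl h
δ-≢ (b ∷ v) (a ∷ e) h with b ℤ.≟ a
... | yes refl rewrite δ-≢ v e (h ∘ cong (b ∷_)) = ℤ.*-zeroʳ ([=0] (a ℤ.- b))
... | no b≢a rewrite [=0]-≢ {a ℤ.- b} (λ eq → b≢a (sym (ℤ.i-j≡0⇒i≡j a b eq))) = refl

-- A Laurent polynomial acting on the series 1 returns its own coefficients; this turns the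
-- numerator into an action.
coeff-δ : ∀ {m} (P : LPoly m) e → coeffₚ P e ≡ (P ⊛ δ) e
coeff-δ [] e = refl
coeff-δ ((c , v) ∷ P) e = cong₂ ℤ._+_ head-term (coeff-δ P e)
  where
  head-term : (if v ==ℤᵥ e then c else + 0) ≡ c ℤ.* δ (e ⊖ v)
  head-term with Vec.≡-dec ℤ._≟_ v e
  ... | yes refl rewrite δ-self v = sym (ℤ.*-identityʳ c)
  ... | no v≢e rewrite δ-≢ v e v≢e = sym (ℤ.*-zeroʳ c)

-- The counting series: interior, boundary and negative exponents

embed : ∀ {m} → Vec ℕ m → Vec ℤ m
embed = Vec.map (λ a → + a)

toℕVec-embed : ∀ {m} (n : Vec ℕ m) → toℕVec (embed n) ≡ just n
toℕVec-embed [] = refl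
toℕVec-embed (a ∷ n) rewrite toℕVec-embed n = refl

data Sign {m : ℕ} : Vec ℤ m → Set where
  natural : ∀ n → Sign (embed n)
  negative : ∀ {e} → toℕVec e ≡ nothing → Sign e

sign : ∀ {m} (e : Vec ℤ m) → Sign e
sign [] = natural []
sign (-[1+ _ ] ∷ e) = negative refl
sign (+ a ∷ e) with sign e
... | natural n = natural (a ∷ n)
... | negative eq = negative (trans-nothing eq)
  where
  trans-nothing : toℕVec e ≡ nothing → toℕVec (+ a ∷ e) ≡ nothing
  trans-nothing eq rewrite eq = refl

FCPSeries-embed : ∀ {d} (n : Vec ℕ (suc d)) → FCPSeries d (embed n) ≡ + fcpCount n
FCPSeries-embed n with toℕVec (embed n) | toℕVec-embed n
... | _ | refl = refl

FCPSeries-negative : ∀ {d} {e : Vec ℤ (suc d)} → toℕVec e ≡ nothing → FCPSeries d e ≡ + 0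
FCPSeries-negative {e = e} eq with toℕVec e | eq
... | _ | refl = refl

down up : ∀ {m} → Fin m → Vec ℤ m → Vec ℤ m
down i = shift i (+ 1)
up i = shift i (ℤ.- (+ 1))

-- The coefficient at e of (Σ x_j^-1) p.
raised : ∀ {m} → Vec ℤ m → ℤ
raised {m} e = sumOver (allFin m) (λ j → positive (up j e))

raised-∷ : ∀ {m} a (e : Vec ℤ m) → raised (a ∷ e) ≡ [>0] (a ℤ.- ℤ.- (+ 1)) ℤ.* positive e ℤ.+ [>0] a ℤ.* raised e
raised-∷ {m} a e = trans (sumOver-allFin-suc (λ j → positive (up j (a ∷ e))))
  (cong (λ s → [>0] (a ℤ.- ℤ.- (+ 1)) ℤ.* positive e ℤ.+ s)
    (sumOver-* ([>0] a) (λ j → positive (up j e)) (allFin m)))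

isZero : ℕ → ℤ
isZero zero = + 1
isZero (suc _) = + 0

positive-embed : ∀ {m} (n : Vec ℕ m) → positive (embed n) ≡ isZero (zeros n)
positive-embed [] = refl
positive-embed (zero ∷ n) = refl
positive-embed (suc _ ∷ n) = trans (ℤ.*-identityˡ _) (positive-embed n)

-- Raising one coordinate gives a positive vector only by removing the sole zero, and then for one
-- choice of coordinate. These are the values of the boundary convention.
raised-embed : ∀ {m z} (n : Vec ℕ m) → zeros n ≡ suc z → raised (embed n) ≡ isZero z
raised-embed {z = z} (zero ∷ n) eq = begin
  raised (+ 0 ∷ embed n) ≡⟨ raised-∷ (+ 0) (embed n) ⟩
  + 1 ℤ.* positive (embed n) ℤ.+ + 0 ℤ.* raised (embed n)
    ≡⟨ cong₂ ℤ._+_ (ℤ.*-identityˡ (positive (embed n))) (ℤ.*-zeroˡ (raised (embed n))) ⟩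
  positive (embed n) ℤ.+ + 0 ≡⟨ ℤ.+-identityʳ _ ⟩
  positive (embed n) ≡⟨ positive-embed n ⟩
  isZero (zeros n) ≡⟨ cong (λ { zero → + 0 ; (suc k) → isZero k }) eq ⟩
  isZero z ∎
  where open ≡-Reasoning
raised-embed {z = z} (suc a ∷ n) eq = begin
  raised (+ suc a ∷ embed n) ≡⟨ raised-∷ (+ suc a) (embed n) ⟩
  [>0] (+ (suc a ℕ.+ 1)) ℤ.* positive (embed n) ℤ.+ + 1 ℤ.* raised (embed n)
    ≡⟨ cong₂ (λ s t → s ℤ.+ t) (trans (cong (λ s → [>0] (+ (suc a ℕ.+ 1)) ℤ.* s) (trans (positive-embed n) (cong isZero eq)))
        (ℤ.*-zeroʳ ([>0] (+ (suc a ℕ.+ 1))))) (ℤ.*-identityˡ (raised (embed n))) ⟩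
  + 0 ℤ.+ raised (embed n) ≡⟨ ℤ.+-identityˡ _ ⟩
  raised (embed n) ≡⟨ raised-embed n eq ⟩
  isZero z ∎
  where open ≡-Reasoning

toℕVec-∷-nothing : ∀ {m} a (e : Vec ℤ m) → toℕVec (+ a ∷ e) ≡ nothing → toℕVec e ≡ nothing
toℕVec-∷-nothing a e eq with toℕVec e
... | nothing = refl

positive-negative : ∀ {m} (e : Vec ℤ m) → toℕVec e ≡ nothing → positive e ≡ + 0
positive-negative (-[1+ _ ] ∷ e) _ = refl
positive-negative (+ a ∷ e) eq = trans
  (cong (λ s → [>0] (+ a) ℤ.* s) (positive-negative e (toℕVec-∷-nothing a e eq))) (ℤ.*-zeroʳ ([>0] (+ a)))

-- Raising repairs no negative coordinate: -1 becomes 0, which is still not positive.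
raised-negative : ∀ {m} (e : Vec ℤ m) → toℕVec e ≡ nothing → raised e ≡ + 0
raised-negative (-[1+ zero ] ∷ e) _ = raised-∷ -[1+ 0 ] e
raised-negative (-[1+ suc k ] ∷ e) _ = raised-∷ -[1+ suc k ] e
raised-negative (+ a ∷ e) eq = trans (raised-∷ (+ a) e) (trans
  (cong₂ (λ s t → [>0] (+ a ℤ.- ℤ.- (+ 1)) ℤ.* s ℤ.+ [>0] (+ a) ℤ.* t)
    (positive-negative e (toℕVec-∷-nothing a e eq)) (raised-negative e (toℕVec-∷-nothing a e eq)))
  (vanish ([>0] (+ a ℤ.- ℤ.- (+ 1))) ([>0] (+ a))))
  where
  vanish : ∀ x y → x ℤ.* + 0 ℤ.+ y ℤ.* + 0 ≡ + 0
  vanish = solve-∀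

interior : ∀ d → Series (suc d)
interior d e = positive e ℤ.* FCPSeries d e

raised-full : ∀ {m} (n : Vec ℕ m) → zeros n ≡ 0 → raised (embed n) ≡ + m
raised-full [] _ = refl
raised-full {suc m} (suc a ∷ n) z = trans (raised-∷ (+ suc a) (embed n)) (cong₂ ℤ._+_
  (cong₂ (λ b s → [>0] (+ b) ℤ.* s) (ℕ.+-comm (suc a) 1) (trans (positive-embed n) (cong isZero z)))
  (trans (ℤ.*-identityˡ _) (raised-full n z)))

from-values : ∀ D {f f′ p p′ r r′} → f ≡ f′ → p ≡ p′ → r ≡ r′ →
  f′ ≡ p′ ℤ.* f′ ℤ.+ (r′ ℤ.- D ℤ.* p′) → f ≡ p ℤ.* f ℤ.+ (r ℤ.- D ℤ.* p)
from-values D refl refl refl h = h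

boundary-count : ∀ {d k} (n : Vec ℕ (suc d)) → zeros n ≡ suc k → + fcpCount n ≡ isZero k
boundary-count n z with zeros n | z
... | suc zero | refl = refl
... | suc (suc _) | refl = refl

-- On positive exponents all d + 1 summands of `raised` equal 1 and cancel against (d + 1) p. On the
-- boundary p vanishes and `raised` is the conventional count. With a negative coordinate every term
-- is 0.
FCPSeries-split : ∀ d e → FCPSeries d e ≡ interior d e ℤ.+ (raised e ℤ.- + suc d ℤ.* positive e)
FCPSeries-split d e with sign e
... | negative eq = from-values (+ suc d) (FCPSeries-negative {e = e} eq) (positive-negative e eq) (raised-negative e eq) (at-negative (+ suc d))
  where
  at-negative : ∀ D → + 0 ≡ + 0 ℤ.* + 0 ℤ.+ (+ 0 ℤ.- D ℤ.* + 0)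
  at-negative = solve-∀
... | natural n with zeros n in z
...   | zero = from-values (+ suc d) (FCPSeries-embed n) (trans (positive-embed n) (cong isZero z)) (raised-full n z)
  (at-interior (+ suc d) (+ fcpCount n))
  where
  at-interior : ∀ D f → f ≡ + 1 ℤ.* f ℤ.+ (D ℤ.- D ℤ.* + 1)
  at-interior = solve-∀
...   | suc k = from-values (+ suc d) (trans (FCPSeries-embed n) (boundary-count n z))
  (trans (positive-embed n) (cong isZero z)) (raised-embed n z) (at-boundary (+ suc d) (isZero k))
  where
  at-boundary : ∀ D f → f ≡ + 0 ℤ.* f ℤ.+ (f ℤ.- D ℤ.* + 0)
  at-boundary = solve-∀

[>0]-idempotent : ∀ a → [>0] a ≡ [>0] a ℤ.* [>0] a
[>0]-idempotent (+ 0) = refl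
[>0]-idempotent (+ suc _) = refl
[>0]-idempotent -[1+ _ ] = refl

positive-idempotent : ∀ {m} (e : Vec ℤ m) → positive e ≡ positive e ℤ.* positive e
positive-idempotent [] = refl
positive-idempotent (a ∷ e) = trans (cong₂ ℤ._*_ ([>0]-idempotent a) (positive-idempotent e))
  (*-interchange ([>0] a) ([>0] a) (positive e) (positive e))

-- For these 0-1 values the product expresses an implication: if e - e_i is positive, so is e. Thus
-- the summands of the recurrence vanish wherever p does.
down-absorb : ∀ {m} (e : Vec ℤ m) i → positive (down i e) ≡ positive e ℤ.* positive (down i e)
down-absorb (a ∷ e) zero = trans (cong₂ ℤ._*_ (scalar a) (positive-idempotent e))
  (*-interchange ([>0] a) ([>0] (a ℤ.- + 1)) (positive e) (positive e))
  where
  scalar : ∀ a → [>0] (a ℤ.- + 1) ≡ [>0] a ℤ.* [>0] (a ℤ.- + 1)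
  scalar (+ 0) = refl
  scalar (+ 1) = refl
  scalar (+ suc (suc k)) = refl
  scalar -[1+ k ] = refl
down-absorb (a ∷ e) (suc i) = trans (cong₂ ℤ._*_ ([>0]-idempotent a) (down-absorb e i))
  (*-interchange ([>0] a) ([>0] a) (positive e) (positive (down i e)))

down-embed : ∀ {m} (n : Vec ℕ m) i → zeros n ≡ 0 → down i (embed n) ≡ embed (lower n i)
down-embed n i z = sym (Vec.map-updateAt n i (pred-embed (zeros-positive n z i)))
  where
  pred-embed : ∀ {a} → 1 ℕ.≤ a → + ℕ.pred a ≡ + a ℤ.- + 1
  pred-embed {suc a} _ = refl

sumOver-fcpCount : ∀ {A : Set} (f : A → ℕ) xs → sumOver xs (λ a → + f a) ≡ + List.foldr (λ a s → f a ℕ.+ s) 0 xs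
sumOver-fcpCount f [] = refl
sumOver-fcpCount f (x ∷ xs) = cong (λ s → + f x ℤ.+ s) (sumOver-fcpCount f xs)

-- The contribution of n - e_i for positive n: the count itself if n - e_i is positive, and the
-- conventional 1 if n_i = 1.
peeled : ∀ d → Vec ℤ (suc d) → Fin (suc d) → ℤ
peeled d e i = interior d (down i e) ℤ.+ (positive e ℤ.- positive (down i e))

peeled-outside : ∀ d e → positive e ≡ + 0 → interior d e ≡ sumOver (allFin (suc d)) (peeled d e)
peeled-outside d e p≡0 = trans (cong (λ p → p ℤ.* FCPSeries d e) p≡0) (trans (ℤ.*-zeroˡ (FCPSeries d e)) (sym (begin
  sumOver (allFin (suc d)) (peeled d e) ≡⟨ sumOver-cong term≡0 (allFin (suc d)) ⟩
  sumOver (allFin (suc d)) (λ _ → + 0) ≡⟨ sumOver-const (suc d) (+ 0) ⟩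
  + suc d ℤ.* + 0 ≡⟨ ℤ.*-zeroʳ (+ suc d) ⟩
  + 0 ∎)))
  where
  open ≡-Reasoning
  q≡0 : ∀ i → positive (down i e) ≡ + 0
  q≡0 i = trans (down-absorb e i) (trans (cong (λ p → p ℤ.* positive (down i e)) p≡0) (ℤ.*-zeroˡ (positive (down i e))))
  vanish : ∀ f → + 0 ℤ.* f ℤ.+ (+ 0 ℤ.- + 0) ≡ + 0
  vanish = solve-∀
  term≡0 : ∀ i → peeled d e i ≡ + 0
  term≡0 i = trans (cong₂ (λ q p → q ℤ.* FCPSeries d (down i e) ℤ.+ (p ℤ.- q)) (q≡0 i) p≡0) (vanish (FCPSeries d (down i e)))

peeled-inside : ∀ d (n : Vec ℕ (suc d)) → zeros n ≡ 0 →
  interior d (embed n) ≡ sumOver (allFin (suc d)) (peeled d (embed n))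
peeled-inside d n z = begin
  positive (embed n) ℤ.* FCPSeries d (embed n) ≡⟨ cong₂ ℤ._*_ p≡1 (FCPSeries-embed n) ⟩
  + 1 ℤ.* + fcpCount n ≡⟨ ℤ.*-identityˡ (+ fcpCount n) ⟩
  + fcpCount n ≡⟨ cong (λ a → + a) (fcpCount-recurrence n z) ⟩
  + List.foldr (λ i s → fcpCount (lower n i) ℕ.+ s) 0 (allFin (suc d))
    ≡⟨ sumOver-fcpCount (fcpCount ∘ lower n) (allFin (suc d)) ⟨
  sumOver (allFin (suc d)) (λ i → + fcpCount (lower n i)) ≡⟨ sumOver-cong term (allFin (suc d)) ⟩
  sumOver (allFin (suc d)) (peeled d (embed n)) ∎
  where
  open ≡-Reasoning
  p≡1 : positive (embed n) ≡ + 1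
  p≡1 = trans (positive-embed n) (cong isZero z)
  kept : ∀ f → f ≡ + 1 ℤ.* f ℤ.+ (+ 1 ℤ.- + 1)
  kept = solve-∀
  substitute : ∀ {f f′ p q q′} → f ≡ f′ → p ≡ + 1 → q ≡ q′ → f′ ≡ q′ ℤ.* f′ ℤ.+ (+ 1 ℤ.- q′) →
    f′ ≡ q ℤ.* f ℤ.+ (p ℤ.- q)
  substitute refl refl refl h = h
  lowered : ∀ i → + fcpCount (lower n i) ≡
    isZero (zeros (lower n i)) ℤ.* + fcpCount (lower n i) ℤ.+ (+ 1 ℤ.- isZero (zeros (lower n i)))
  lowered i with zeros-lower n i z
  ... | inj₁ z′ = trans (kept _) (cong (λ k → isZero k ℤ.* + fcpCount (lower n i) ℤ.+ (+ 1 ℤ.- isZero k)) (sym z′))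
  ... | inj₂ z′ = trans (boundary-count (lower n i) z′)
    (cong (λ k → isZero k ℤ.* + fcpCount (lower n i) ℤ.+ (+ 1 ℤ.- isZero k)) (sym z′))
  term : ∀ i → + fcpCount (lower n i) ≡ peeled d (embed n) i
  term i = subst (λ e → + fcpCount (lower n i) ≡
      positive e ℤ.* FCPSeries d e ℤ.+ (positive (embed n) ℤ.- positive e)) (sym (down-embed n i z))
    (substitute (FCPSeries-embed (lower n i)) p≡1 (positive-embed (lower n i)) (lowered i))

interior-recurrence : ∀ d e → interior d e ≡ sumOver (allFin (suc d)) (peeled d e)
interior-recurrence d e with sign e
... | negative eq = peeled-outside d e (positive-negative e eq)
... | natural n with zeros n in z
...   | zero = peeled-inside d n z
...   | suc k = peeled-outside d (embed n) (trans (positive-embed n) (cong isZero z))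

bracket : (d : ℕ) → LPoly (suc d)
bracket d = sumₚ (allFin (suc d)) (λ i → varInv i +ₚ (constₚ (+ d) *ₚ var i))
  -ₚ sumₚ (allFin (suc d)) (λ i → sumₚ (allFin (suc d)) (λ j → var i *ₚ varInv j))

bracket-positive : ∀ d e → (bracket d ⊛ positive) e ≡
  sumOver (allFin (suc d)) (λ i → (positive (up i e) ℤ.+ + d ℤ.* positive (down i e)) ℤ.- raised (down i e))
bracket-positive d e = trans (⊛-minus (sumₚ Is L) (sumₚ Is Q) positive e) (trans (cong₂ ℤ._-_
    (trans (⊛-sum Is L positive e) (sumOver-cong linear Is))
    (trans (⊛-sum Is Q positive e) (sumOver-cong quadratic Is)))
  (sym (sumOver-minus (λ i → positive (up i e) ℤ.+ + d ℤ.* positive (down i e)) (λ i → raised (down i e)) Is)))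
  where
  Is : List (Fin (suc d))
  Is = allFin (suc d)
  L Q : Fin (suc d) → LPoly (suc d)
  L i = varInv i +ₚ (constₚ (+ d) *ₚ var i)
  Q i = sumₚ Is (λ j → var i *ₚ varInv j)
  linear : ∀ i → (L i ⊛ positive) e ≡ positive (up i e) ℤ.+ + d ℤ.* positive (down i e)
  linear i = trans (⊛-++ (varInv i) (constₚ (+ d) *ₚ var i) positive e) (cong₂ ℤ._+_
    (⊛-varPow i (ℤ.- (+ 1)) positive e)
    (trans (⊛-* (constₚ (+ d)) (var i) positive e) (trans (⊛-const (+ d) (var i ⊛ positive) e)
      (cong (λ s → + d ℤ.* s) (⊛-varPow i (+ 1) positive e)))))
  quadratic : ∀ i → (Q i ⊛ positive) e ≡ raised (down i e)
  quadratic i = trans (⊛-sum Is (λ j → var i *ₚ varInv j) positive e) (sumOver-cong (λ j →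
    trans (⊛-* (var i) (varInv j) positive e) (trans (⊛-varPow i (+ 1) (varInv j ⊛ positive) e)
      (⊛-varPow j (ℤ.- (+ 1)) positive (down i e)))) Is)

-- Expand F(e) with FCPSeries-split and interior-recurrence, expand each F(down i e) with FCPSeries-split,
-- and compare the summands for each i.
bracket-FCPSeries : ∀ d → (constₚ (+ 1) -ₚ sumₚ (allFin (suc d)) var) ⊛ FCPSeries d ≐ bracket d ⊛ positive
bracket-FCPSeries d e = begin
  ((constₚ (+ 1) -ₚ sumₚ Is var) ⊛ F) e ≡⟨ ⊛-minus (constₚ (+ 1)) (sumₚ Is var) F e ⟩
  (constₚ (+ 1) ⊛ F) e ℤ.- (sumₚ Is var ⊛ F) e ≡⟨ cong₂ ℤ._-_
    (trans (⊛-const (+ 1) F e) (ℤ.*-identityˡ (F e)))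
    (trans (⊛-sum Is var F e) (sumOver-cong (λ i → ⊛-varPow i (+ 1) F e) Is)) ⟩
  F e ℤ.- sumOver Is (λ i → F (down i e)) ≡⟨ cong (λ s → s ℤ.- sumOver Is (λ i → F (down i e))) F-sum ⟩
  sumOver Is (λ i → peeled d e i ℤ.+ (positive (up i e) ℤ.- positive e)) ℤ.- sumOver Is (λ i → F (down i e))
    ≡⟨ sumOver-minus (λ i → peeled d e i ℤ.+ (positive (up i e) ℤ.- positive e)) (λ i → F (down i e)) Is ⟨
  sumOver Is (λ i → (peeled d e i ℤ.+ (positive (up i e) ℤ.- positive e)) ℤ.- F (down i e)) ≡⟨ sumOver-cong term Is ⟩
  sumOver Is (λ i → (positive (up i e) ℤ.+ + d ℤ.* positive (down i e)) ℤ.- raised (down i e)) ≡⟨ bracket-positive d e ⟨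
  (bracket d ⊛ positive) e ∎
  where
  open ≡-Reasoning
  F : Series (suc d)
  F = FCPSeries d
  Is : List (Fin (suc d))
  Is = allFin (suc d)
  F-sum : F e ≡ sumOver Is (λ i → peeled d e i ℤ.+ (positive (up i e) ℤ.- positive e))
  F-sum = trans (FCPSeries-split d e) (trans (cong₂ ℤ._+_ (interior-recurrence d e)
    (trans (cong (λ s → raised e ℤ.- s) (sym (sumOver-const (suc d) (positive e))))
      (sym (sumOver-minus (λ i → positive (up i e)) (λ _ → positive e) Is))))
    (sym (sumOver-+ (peeled d e) (λ i → positive (up i e) ℤ.- positive e) Is)))
  term : ∀ i → (peeled d e i ℤ.+ (positive (up i e) ℤ.- positive e)) ℤ.- F (down i e) ≡
    (positive (up i e) ℤ.+ + d ℤ.* positive (down i e)) ℤ.- raised (down i e)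
  term i = trans (cong (λ s → (peeled d e i ℤ.+ (positive (up i e) ℤ.- positive e)) ℤ.- s) (FCPSeries-split d (down i e)))
    (cancel (interior d (down i e)) (positive e) (positive (down i e)) (positive (up i e)) (raised (down i e)) (+ d))
    where
    -- The factor 1 + D is the number of coordinates, from `FCPSeries-split`; one copy of q cancels
    -- the -q from `peeled`, which leaves D.
    cancel : ∀ g p q u r D → ((g ℤ.+ (p ℤ.- q)) ℤ.+ (u ℤ.- p)) ℤ.- (g ℤ.+ (r ℤ.- (+ 1 ℤ.+ D) ℤ.* q)) ≡ (u ℤ.+ D ℤ.* q) ℤ.- r
    cancel = solve-∀

theorem1p1 : (d : ℕ) (e : Vec ℤ (suc d)) →
    (denominator d ⊛ FCPSeries d) e ≡ coeffₚ (numerator d) e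
theorem1p1 d e = begin
  (denominator d ⊛ FCPSeries d) e ≡⟨ ⊛-* 1-Σx ∏1-x (FCPSeries d) e ⟩
  -- The factors are exchanged so that 1 - Σ x_i meets F directly and turns it into Q p; the other
  -- factor then only has to act on p.
  (1-Σx ⊛ (∏1-x ⊛ FCPSeries d)) e ≡⟨ ⊛-comm 1-Σx ∏1-x (FCPSeries d) e ⟩
  (∏1-x ⊛ (1-Σx ⊛ FCPSeries d)) e ≡⟨ ⊛-cong ∏1-x (bracket-FCPSeries d) e ⟩
  (∏1-x ⊛ (bracket d ⊛ positive)) e ≡⟨ ⊛-comm ∏1-x (bracket d) positive e ⟩
  (bracket d ⊛ (∏1-x ⊛ positive)) e ≡⟨ ⊛-cong (bracket d) prod-positive e ⟩
  (bracket d ⊛ (∏x ⊛ δ)) e ≡⟨ ⊛-comm (bracket d) ∏x δ e ⟩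
  (∏x ⊛ (bracket d ⊛ δ)) e ≡⟨ ⊛-* ∏x (bracket d) δ e ⟨
  (numerator d ⊛ δ) e ≡⟨ coeff-δ (numerator d) e ⟨
  coeffₚ (numerator d) e ∎
  where
  open ≡-Reasoning
  1-Σx ∏1-x ∏x : LPoly (suc d)
  1-Σx = constₚ (+ 1) -ₚ sumₚ (allFin (suc d)) var
  ∏1-x = prodₚ (allFin (suc d)) (λ i → constₚ (+ 1) -ₚ var i)
  ∏x = prodₚ (allFin (suc d)) var
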